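{- For any integer $n\ge0$, $$\widetilde{A}_n(q,t)=\sum_{\sigma\in\widetilde{\mathfrak{S}}_n}q^{\mathrm{maj}(\sigma)-\mathrm{exc}(\sigma)}t^{\mathrm{exc}(\sigma)+1}.$$
   Context: For $\pi\in\mathfrak{S}_k$, $\mathrm{maj}(\pi)=\sum_{i:\pi_i>\pi_{i+1}}i$ and $\mathrm{exc}(\pi)=|\{i:\pi_i>i\}|$. For $k\ge1$ put $A_k(q,t)=\sum_{\pi\in\mathfrak{S}_k}q^{\mathrm{maj}(\pi)-\mathrm{exc}(\pi)}t^{\mathrm{exc}(\pi)}$. The $q$-binomial Eulerian polynomial is $$\widetilde A_n(q,t)=1+t\sum_{k=1}^n\begin{bmatrix}n\\k\end{bmatrix}_qA_k(q,t),$$ where $\begin{bmatrix}n\\k\end{bmatrix}_q=\frac{[n]_q!}{[k]_q![n-k]_q!}$, $[m]_q!=\prod_{i=1}^m[i]_q$, $[i]_q=1+q+\cdots+q^{i-1}$. A decorated permutation of $[n]$ is a permutation of a subset $S\subseteq[n]$; its one-line notation is the word $\sigma=\sigma_1\cdots\sigma_n$ over $\{0,1,\dots,n\}$ where $\sigma_i$ is the image of $i$ if $i\in S$ and $\sigma_i=0$ if $i\notin S$. $\widetilde{\mathfrak{S}}_n$ is the set of decorated permutations of $[n]$ and $\theta=00\cdots0$ is the one with $S=\emptyset$. For $\sigma\in\widetilde{\mathfrak{S}}_n$ with $\sigma\ne\theta$ set $\mathrm{exc}(\sigma)=|\{i\in[n]:i<\sigma_i\}|$ and $\mathrm{maj}(\sigma)=\sum_{i\in[n-1]:\sigma_i>\sigma_{i+1}}i$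 (comparison of integers); set $\mathrm{exc}(\theta)=\mathrm{maj}(\theta)=-1$. -}

module Defs where

open import Data.Bool.Base using (if_then_else_)
open import Data.Fin.Base using (Fin; zero; suc; toℕ; inject₁)
open import Data.Fin.Properties using (all?; any?) renaming (_≟_ to _≟ᶠ_; _<?_ to _<ᶠ?_)
open import Data.Fin.Subset using (Subset; inside; outside; ⊤; _∈_; _∉_)
open import Data.Fin.Subset.Properties using (_∈?_)
open import Data.Integer.Base as ℤ using (ℤ; +_; -1ℤ; 0ℤ; 1ℤ)
open import Data.Integer.Properties as ℤₚ using ()
open import Data.List.Base as List using (List; []; _∷_; [_]; _++_; map; concatMap; filter; length; upTo; allFin; cartesianProductWith)
open import Data.Nat.Base as ℕ using (ℕ; zero; suc; _∸_)
open import Data.Nat.ListAction using (sum)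
open import Data.Product.Base using (_×_; _,_; ∃)
open import Data.Sum.Base using ([_,_]′)
open import Data.Vec.Base as Vec using (Vec; []; _∷_; lookup; replicate)
open import Data.Vec.Properties using (≡-dec)
open import Relation.Binary.PropositionalEquality using (_≡_; _≢_; refl; sym; trans; cong; cong₂; module ≡-Reasoning)
open import Relation.Nullary.Decidable using (Dec; does; ¬?; _×-dec_; _→-dec_)

-- Laurent polynomials in q and t over ℤ.
-- term c a b  is  c · q^a · t^b ; a Laurent polynomial is a formal
-- sum of terms, and two of them are equal when all coefficients agree.

record Term : Set where
  constructor term
  field
    coefficient : ℤ
    q-exponent  : ℤ
    t-exponent  : ℤ

Laurent : Set
Laurent = List Term

coeff : Laurent → ℤ → ℤ → ℤ
coeff []               i j = 0ℤ
coeff (term c a b ∷ p) i j =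
  (if does ((a ℤₚ.≟ i) ×-dec (b ℤₚ.≟ j)) then c else 0ℤ) ℤ.+ coeff p i j

infix 4 _≈_
_≈_ : Laurent → Laurent → Set
p ≈ r = ∀ i j → coeff p i j ≡ coeff r i j

infixl 6 _+_
infixl 7 _*_

0# 1# : Laurent
0# = []
1# = [ term 1ℤ 0ℤ 0ℤ ]

_+_ : Laurent → Laurent → Laurent
_+_ = _++_

_*ᵗ_ : Term → Term → Term
term c a b *ᵗ term c′ a′ b′ = term (c ℤ.* c′) (a ℤ.+ a′) (b ℤ.+ b′)

_*_ : Laurent → Laurent → Laurent
_*_ = cartesianProductWith _*ᵗ_

q^_ t^_ : ℤ → Laurent
q^ a = [ term 1ℤ a 0ℤ ]
t^ b = [ term 1ℤ 0ℤ b ]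

∑ : {A : Set} → List A → (A → Laurent) → Laurent
∑ xs f = List.foldr (λ x s → f x + s) 0# xs

-- The value at q = t = 1.
at1 : Laurent → ℤ
at1 []               = 0ℤ
at1 (term c _ _ ∷ p) = c ℤ.+ at1 p

at1-+ : ∀ p r → at1 (p + r) ≡ at1 p ℤ.+ at1 r
at1-+ []               r = sym (ℤₚ.+-identityˡ (at1 r))
at1-+ (term c _ _ ∷ p) r =
  trans (cong (λ z → c ℤ.+ z) (at1-+ p r)) (sym (ℤₚ.+-assoc c (at1 p) (at1 r)))

at1-*ᵗ : ∀ c a b r → at1 (map (term c a b *ᵗ_) r) ≡ c ℤ.* at1 r
at1-*ᵗ c a b []                = sym (ℤₚ.*-zeroʳ c)
at1-*ᵗ c a b (term c′ _ _ ∷ r) =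
  trans (cong (λ z → c ℤ.* c′ ℤ.+ z) (at1-*ᵗ c a b r)) (sym (ℤₚ.*-distribˡ-+ c c′ (at1 r)))

at1-* : ∀ p r → at1 (p * r) ≡ at1 p ℤ.* at1 r
at1-* []               r = refl
at1-* (term c a b ∷ p) r = begin
  at1 (map (term c a b *ᵗ_) r ++ p * r)          ≡⟨ at1-+ (map (term c a b *ᵗ_) r) (p * r) ⟩
  at1 (map (term c a b *ᵗ_) r) ℤ.+ at1 (p * r)   ≡⟨ cong₂ ℤ._+_ (at1-*ᵗ c a b r) (at1-* p r) ⟩
  c ℤ.* at1 r ℤ.+ at1 p ℤ.* at1 r                ≡⟨ ℤₚ.*-distribʳ-+ (at1 r) c (at1 p) ⟨
  (c ℤ.+ at1 p) ℤ.* at1 r                        ∎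
  where open ≡-Reasoning

at1-*-≢0 : ∀ p r → at1 p ≢ 0ℤ → at1 r ≢ 0ℤ → at1 (p * r) ≢ 0ℤ
at1-*-≢0 p r p≢0 r≢0 pr≡0 =
  [ p≢0 , r≢0 ]′ (ℤₚ.i*j≡0⇒i≡0∨j≡0 (at1 p) (trans (sym (at1-* p r)) pr≡0))

-- Requiring that the denominator does not vanish at q = t = 1 makes it nonzero
-- and holds for all q-factorials.  These fractions form a subring of the field
-- ℚ(q,t), and cross-multiplication is equality there, since ℤ[q^±1,t^±1] is an
-- integral domain.

record Fraction : Set where
  field
    num     : Laurent
    den     : Laurent
    den≢0   : at1 den ≢ 0ℤ

open Fraction

infix 4 _≃_
_≃_ : Fraction → Fraction → Set
x ≃ y = num x * den y ≈ num y * den x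

ι : Laurent → Fraction
ι p = record { num = p ; den = 1# ; den≢0 = λ () }

infixl 6 _⊕_
infixl 7 _⊗_

_⊕_ : Fraction → Fraction → Fraction
x ⊕ y = record
  { num   = num x * den y + num y * den x
  ; den   = den x * den y
  ; den≢0 = at1-*-≢0 (den x) (den y) (den≢0 x) (den≢0 y)
  }

_⊗_ : Fraction → Fraction → Fraction
x ⊗ y = record
  { num   = num x * num y
  ; den   = den x * den y
  ; den≢0 = at1-*-≢0 (den x) (den y) (den≢0 x) (den≢0 y)
  }

∑ᶠ : {A : Set} → List A → (A → Fraction) → Fraction
∑ᶠ xs f = List.foldr (λ x s → f x ⊕ s) (ι 0#) xs

[_]q : ℕ → Laurent
[ i ]q = ∑ (upTo i) (λ j → q^ (+ j))

[_]q! : ℕ → Laurent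
[ zero  ]q! = 1#
[ suc m ]q! = [ m ]q! * [ suc m ]q

at1-∑q^ : ∀ (xs : List ℕ) → at1 (∑ xs (λ j → q^ (+ j))) ≡ + length xs
at1-∑q^ []       = refl
at1-∑q^ (x ∷ xs) = cong (λ z → 1ℤ ℤ.+ z) (at1-∑q^ xs)

[_]q!≢0 : ∀ m → at1 [ m ]q! ≢ 0ℤ
[ zero  ]q!≢0 ()
[ suc m ]q!≢0 = at1-*-≢0 [ m ]q! [ suc m ]q [ m ]q!≢0 λ e → +suc≢0 (trans (sym (at1-∑q^ (upTo (suc m)))) e)
  where
  +suc≢0 : ∀ {k} → + suc k ≢ 0ℤ
  +suc≢0 ()

-- Meaningful for k ≤ n.
qBinomial : ℕ → ℕ → Fraction
qBinomial n k = record
  { num   = [ n ]q!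
  ; den   = [ k ]q! * [ n ∸ k ]q!
  ; den≢0 = at1-*-≢0 [ k ]q! [ n ∸ k ]q! [ k ]q!≢0 [ n ∸ k ]q!≢0
  }

-- Words of length n over {0,…,n}.  The i : Fin n in a position or in a subset
-- is the element i + 1 of [n], which as a letter is  suc i : Fin (suc n).

Word : ℕ → Set
Word n = Vec (Fin (suc n)) n

allVecs : {A : Set} → List A → ∀ n → List (Vec A n)
allVecs xs zero    = [ [] ]
allVecs xs (suc n) = cartesianProductWith _∷_ xs (allVecs xs n)

allSubsets : ∀ n → List (Subset n)
allSubsets = allVecs (inside ∷ outside ∷ [])

allWords : ∀ n → List (Word n)
allWords n = allVecs (allFin (suc n)) n

-- The four conditions: 0 off S, S is mapped to S, injectively, surjectively.
IsPermutationOf : ∀ {n} → Subset n → Word n → Set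
IsPermutationOf S w =
    (∀ i → i ∉ S → lookup w i ≡ zero)
  × (∀ i → i ∈ S → ∃ λ j → j ∈ S × lookup w i ≡ suc j)
  × (∀ i j → i ∈ S → j ∈ S → lookup w i ≡ lookup w j → i ≡ j)
  × (∀ j → j ∈ S → ∃ λ i → i ∈ S × lookup w i ≡ suc j)

isPermutationOf? : ∀ {n} (S : Subset n) (w : Word n) → Dec (IsPermutationOf S w)
isPermutationOf? S w =
        all? (λ i → ¬? (i ∈? S) →-dec lookup w i ≟ᶠ zero)
  ×-dec all? (λ i → i ∈? S →-dec any? (λ j → j ∈? S ×-dec lookup w i ≟ᶠ suc j))
  ×-dec all? (λ i → all? (λ j → i ∈? S →-dec j ∈? S →-dec lookup w i ≟ᶠ lookup w j →-dec i ≟ᶠ j))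
  ×-dec all? (λ j → j ∈? S →-dec any? (λ i → i ∈? S ×-dec lookup w i ≟ᶠ suc j))

permutationsOf : ∀ {n} → Subset n → List (Word n)
permutationsOf {n} S = filter (isPermutationOf? S) (allWords n)

permutations : ∀ k → List (Word k)
permutations k = permutationsOf ⊤

-- 𝔖̃ₙ ; no word is repeated, since S is the set of positions of nonzero letters.
decoratedPermutations : ∀ n → List (Word n)
decoratedPermutations n = concatMap permutationsOf (allSubsets n)

exc : ∀ {n} → Word n → ℕ
exc {n} w = length (filter (λ i → suc i <ᶠ? lookup w i) (allFin n))

maj : ∀ {n} → Word n → ℕ
maj {zero}  w = 0
maj {suc m} w =
  sum (map (λ i → suc (toℕ i))
           (filter (λ i → lookup w (suc i) <ᶠ? lookup w (inject₁ i)) (allFin m)))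

θ : ∀ {n} → Word n
θ {n} = replicate n zero

-- The versions for decorated permutations, with value -1 at θ.
excᵈ majᵈ : ∀ {n} → Word n → ℤ
excᵈ σ = if does (≡-dec _≟ᶠ_ σ θ) then -1ℤ else + exc σ
majᵈ σ = if does (≡-dec _≟ᶠ_ σ θ) then -1ℤ else + maj σ

A : ℕ → Laurent
A k = ∑ (permutations k) (λ π → q^ (+ maj π ℤ.- + exc π) * t^ (+ exc π))

Ã : ℕ → Fraction
Ã n = ι 1# ⊕ ι (t^ 1ℤ) ⊗ ∑ᶠ (map suc (upTo n)) (λ k → qBinomial n k ⊗ ι (A k))

{-# OPTIONS --safe #-}

-- A decorated permutation of S with ∣S∣ = k is a permutation π of [k] whose
-- letters are relabelled increasingly and spread over the positions in S, the
-- remaining positions being filled with 0.  This keeps exc, and its descents are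
-- those of π with zeros inserted.  So it suffices that, for a word π of k positive
-- letters, the sum of q^maj over all insertions of m zeros is q^maj(π) times the
-- q-binomial coefficient (a special case of the Garsia–Gessel shuffle theorem).
-- Splitting by the last letter, the insertions ending in 0 and those ending in the
-- last letter of π satisfy recurrences that are solved explicitly; multiplying
-- through by [k]! [m]! turns them into [a + b] = [a] + q^a [b], so that neither
-- q-binomial coefficients nor cancellation are needed.

module Submission where

open import Defs
open import Data.Nat.Base using (ℕ)
open import Data.Integer.Base using (1ℤ) renaming (_+_ to _+ℤ_; _-_ to _-ℤ_)

open import Algebra.Bundles using (CommutativeSemiring)
import Algebra.Structures.Biased as Biased
import Algebra.Properties.CommutativeSemigroup as CommutativeSemigroup
open import Data.Bool.Base using (Bool; true; false; if_then_else_)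
open import Data.Empty using (⊥-elim)
open import Data.Fin.Base using (Fin; zero; suc; toℕ; inject₁)
open import Data.Fin.Properties using (0≢1+n; suc-injective; ¬Fin0) renaming (_<?_ to _<ᶠ?_; _≟_ to _≟ᶠ_)
open import Data.Fin.Subset using (Subset; inside; outside; ⊤; ∣_∣; _∈_; _∉_)
open import Data.Fin.Subset.Properties using (_∈?_; ∈⊤; ∣p∣≤n; ∣⊤∣≡n)
open import Data.Integer.Base as ℤ using (+_; 0ℤ)
import Data.Integer.Properties as ℤₚ
open import Data.List.Base as List
  using (List; []; _∷_; [_]; _++_; map; concatMap; filter; length; tabulate; upTo)
open import Data.List.Membership.Propositional.Properties
  using (∈-map⁺; ∈-map⁻; ∈-filter⁺; ∈-filter⁻; ∈-cartesianProductWith⁺; ∈-allFin; ∈-upTo⁻)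
open import Data.List.Membership.Propositional.Properties.WithK using (unique∧set⇒bag)
open import Data.List.Membership.Propositional using () renaming (_∈_ to _∈ˡ_)
open import Data.List.Properties using (++-assoc; ++-identityʳ; map-++; map-∘; map-cong; map-upTo; upTo-∷ʳ)
open import Data.List.Relation.Binary.BagAndSetEquality using (∼bag⇒↭)
open import Data.List.Relation.Binary.Permutation.Propositional as ↭ using (_↭_; prep; swap)
open import Data.List.Relation.Unary.All using ([])
open import Data.List.Relation.Unary.AllPairs using ([]; _∷_)
open import Data.List.Relation.Unary.Any using (here; there)
open import Data.List.Relation.Unary.Unique.Propositional using (Unique)
import Data.List.Relation.Unary.Unique.Propositional.Properties as Unique
open import Data.Nat.Base as ℕ using (zero; suc; _∸_; _<_; _<ᵇ_; s≤s)
open import Data.Nat.ListAction using (sum)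
import Data.Nat.Properties as ℕₚ
open import Data.Product.Base using (∃; _×_; _,_; proj₁; proj₂)
open import Data.Vec.Base as Vec using (Vec; []; _∷_; _∷ʳ_; lookup; here; there)
import Data.Vec.Properties as Vecₚ
open import Function.Base using (_∘_)
open import Function.Bundles using (mk⇔)
open import Level using (0ℓ)
open import Relation.Binary.PropositionalEquality
  using (_≡_; _≢_; _≗_; refl; sym; trans; cong; cong₂; subst; module ≡-Reasoning)
open import Relation.Binary.Structures using (IsEquivalence)
open import Relation.Nullary.Decidable using (does; yes; no; dec-true; dec-false; does-⇔; _×-dec_)
open import Relation.Unary using (Pred; Decidable)

open Fraction

private variable
  X Y : Set

-- The commutative semiring of Laurent polynomials

-- _≈_ unfolds to a function type from which its arguments cannot be inferred.
infix 4 _≋_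
record _≋_ (p r : Laurent) : Set where
  constructor mk≋
  field coeff-≡ : p ≈ r
open _≋_

≡⇒≋ : ∀ {p r} → p ≡ r → p ≋ r
≡⇒≋ refl = mk≋ λ _ _ → refl

coeff-+ : ∀ p r i j → coeff (p + r) i j ≡ coeff p i j ℤ.+ coeff r i j
coeff-+ []               r i j = sym (ℤₚ.+-identityˡ _)
coeff-+ (term c a b ∷ p) r i j =
  trans (cong (λ z → c′ ℤ.+ z) (coeff-+ p r i j)) (sym (ℤₚ.+-assoc c′ (coeff p i j) _))
  where c′ = if does ((a ℤₚ.≟ i) ×-dec (b ℤₚ.≟ j)) then c else 0ℤ

private
  shift : ∀ a {a′ i} → a ℤ.+ a′ ≡ i → a′ ≡ i ℤ.- a
  shift a {a′} refl = begin
    a′                       ≡⟨ ℤₚ.+-identityˡ a′ ⟨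
    0ℤ ℤ.+ a′                ≡⟨ cong (λ z → z ℤ.+ a′) (ℤₚ.+-inverseˡ a) ⟨
    ℤ.- a ℤ.+ a ℤ.+ a′       ≡⟨ ℤₚ.+-assoc (ℤ.- a) a a′ ⟩
    ℤ.- a ℤ.+ (a ℤ.+ a′)     ≡⟨ ℤₚ.+-comm (ℤ.- a) _ ⟩
    a ℤ.+ a′ ℤ.- a           ∎
    where open ≡-Reasoning

  unshift : ∀ a {a′ i} → a′ ≡ i ℤ.- a → a ℤ.+ a′ ≡ i
  unshift a {i = i} refl = begin
    a ℤ.+ (i ℤ.- a)          ≡⟨ ℤₚ.+-comm a _ ⟩
    i ℤ.- a ℤ.+ a            ≡⟨ ℤₚ.+-assoc i (ℤ.- a) a ⟩
    i ℤ.+ (ℤ.- a ℤ.+ a)      ≡⟨ cong (λ z → i ℤ.+ z) (ℤₚ.+-inverseˡ a) ⟩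
    i ℤ.+ 0ℤ                 ≡⟨ ℤₚ.+-identityʳ i ⟩
    i                        ∎
    where open ≡-Reasoning

  *-if : ∀ c b x → (if b then c ℤ.* x else 0ℤ) ≡ c ℤ.* (if b then x else 0ℤ)
  *-if c true  x = refl
  *-if c false x = sym (ℤₚ.*-zeroʳ c)

-- A term with exponents `a′` and `b′` counts on the left exactly when `a + a′ = i` and
-- `b + b′ = j`; solving for `a′` and `b′` gives the shifted indices. That products respect `_≋_`
-- rests on this.
coeff-map-*ᵗ : ∀ c a b r i j →
  coeff (map (term c a b *ᵗ_) r) i j ≡ c ℤ.* coeff r (i ℤ.- a) (j ℤ.- b)
coeff-map-*ᵗ c a b []                  i j = sym (ℤₚ.*-zeroʳ c)
coeff-map-*ᵗ c a b (term c′ a′ b′ ∷ r) i j = begin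
  (if does (d (a ℤ.+ a′) i (b ℤ.+ b′) j) then c ℤ.* c′ else 0ℤ) ℤ.+ coeff (map (term c a b *ᵗ_) r) i j
    ≡⟨ cong₂ ℤ._+_ (cong (λ z → if z then c ℤ.* c′ else 0ℤ) same) (coeff-map-*ᵗ c a b r i j) ⟩
  (if does (d a′ (i ℤ.- a) b′ (j ℤ.- b)) then c ℤ.* c′ else 0ℤ) ℤ.+ c ℤ.* coeff r (i ℤ.- a) (j ℤ.- b)
    ≡⟨ cong (λ z → z ℤ.+ c ℤ.* coeff r (i ℤ.- a) (j ℤ.- b)) (*-if c (does (d a′ (i ℤ.- a) b′ (j ℤ.- b))) c′) ⟩
  c ℤ.* (if does (d a′ (i ℤ.- a) b′ (j ℤ.- b)) then c′ else 0ℤ) ℤ.+ c ℤ.* coeff r (i ℤ.- a) (j ℤ.- b)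
    ≡⟨ ℤₚ.*-distribˡ-+ c _ _ ⟨
  c ℤ.* coeff (term c′ a′ b′ ∷ r) (i ℤ.- a) (j ℤ.- b) ∎
  where
  open ≡-Reasoning
  d = λ x x′ y y′ → (x ℤₚ.≟ x′) ×-dec (y ℤₚ.≟ y′)
  same : does (d (a ℤ.+ a′) i (b ℤ.+ b′) j) ≡ does (d a′ (i ℤ.- a) b′ (j ℤ.- b))
  same = does-⇔ (mk⇔ (λ (e , f) → shift a e , shift b f) (λ (e , f) → unshift a e , unshift b f))
    (d (a ℤ.+ a′) i (b ℤ.+ b′) j) (d a′ (i ℤ.- a) b′ (j ℤ.- b))

+-cong : ∀ {p p′ r r′} → p ≋ p′ → r ≋ r′ → p + r ≋ p′ + r′
+-cong {p} {p′} {r} {r′} (mk≋ e) (mk≋ f) = mk≋ λ i j →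
  trans (coeff-+ p r i j) (trans (cong₂ ℤ._+_ (e i j) (f i j)) (sym (coeff-+ p′ r′ i j)))

+-comm : ∀ p r → p + r ≋ r + p
+-comm p r = mk≋ λ i j →
  trans (coeff-+ p r i j) (trans (ℤₚ.+-comm (coeff p i j) _) (sym (coeff-+ r p i j)))

≋-sym : ∀ {p r} → p ≋ r → r ≋ p
≋-sym (mk≋ e) = mk≋ λ i j → sym (e i j)

≋-trans : ∀ {p r s} → p ≋ r → r ≋ s → p ≋ s
≋-trans (mk≋ e) (mk≋ f) = mk≋ λ i j → trans (e i j) (f i j)

map-*ᵗ-cong : ∀ x {p r} → p ≋ r → map (x *ᵗ_) p ≋ map (x *ᵗ_) r
map-*ᵗ-cong (term c a b) {p} {r} (mk≋ e) = mk≋ λ i j →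
  trans (coeff-map-*ᵗ c a b p i j) (trans (cong (λ z → c ℤ.* z) (e _ _)) (sym (coeff-map-*ᵗ c a b r i j)))

*-congˡ : ∀ p {r s} → r ≋ s → p * r ≋ p * s
*-congˡ []      e = ≡⇒≋ refl
*-congˡ (x ∷ p) e = +-cong (map-*ᵗ-cong x e) (*-congˡ p e)

*ᵗ-comm : ∀ x y → x *ᵗ y ≡ y *ᵗ x
*ᵗ-comm (term c a b) (term c′ a′ b′)
  rewrite ℤₚ.*-comm c c′ | ℤₚ.+-comm a a′ | ℤₚ.+-comm b b′ = refl

*ᵗ-assoc : ∀ x y z → (x *ᵗ y) *ᵗ z ≡ x *ᵗ (y *ᵗ z)
*ᵗ-assoc (term c a b) (term c′ a′ b′) (term c″ a″ b″)
  rewrite ℤₚ.*-assoc c c′ c″ | ℤₚ.+-assoc a a′ a″ | ℤₚ.+-assoc b b′ b″ = refl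

*-zeroʳ-≡ : ∀ p → p * 0# ≡ 0#
*-zeroʳ-≡ []      = refl
*-zeroʳ-≡ (x ∷ p) = *-zeroʳ-≡ p

-- `_*_` recurses on its left factor. This is the matching recursion on the right factor, from which
-- commutativity follows by induction.
*-∷ : ∀ p x r → p * (x ∷ r) ≋ map (x *ᵗ_) p + p * r
*-∷ []      x r = ≡⇒≋ refl
*-∷ (y ∷ p) x r = +-cong (≡⇒≋ (cong [_] (*ᵗ-comm y x))) step
  where
  step : map (y *ᵗ_) r + p * (x ∷ r) ≋ map (x *ᵗ_) p + (map (y *ᵗ_) r + p * r)
  step = ≋-trans (+-cong {map (y *ᵗ_) r} (≡⇒≋ refl) (*-∷ p x r))
        (≋-trans (≡⇒≋ (sym (++-assoc (map (y *ᵗ_) r) _ _)))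
        (≋-trans (+-cong (+-comm (map (y *ᵗ_) r) (map (x *ᵗ_) p)) (≡⇒≋ refl))
                 (≡⇒≋ (++-assoc (map (x *ᵗ_) p) _ _))))

*-comm : ∀ p r → p * r ≋ r * p
*-comm p []      = ≡⇒≋ (*-zeroʳ-≡ p)
*-comm p (x ∷ r) = ≋-trans (*-∷ p x r) (+-cong {map (x *ᵗ_) p} (≡⇒≋ refl) (*-comm p r))

*-distribʳ-≡ : ∀ s p r → (p + r) * s ≡ p * s + r * s
*-distribʳ-≡ s []      r = refl
*-distribʳ-≡ s (x ∷ p) r = trans (cong (map (x *ᵗ_) s ++_) (*-distribʳ-≡ s p r))
                               (sym (++-assoc (map (x *ᵗ_) s) _ _))

map-*ᵗ-* : ∀ x p r → map (x *ᵗ_) p * r ≡ map (x *ᵗ_) (p * r)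
map-*ᵗ-* x []      r = refl
map-*ᵗ-* x (y ∷ p) r = trans (cong₂ _++_ eq (map-*ᵗ-* x p r)) (sym (map-++ (x *ᵗ_) (map (y *ᵗ_) r) _))
  where
  eq : map ((x *ᵗ y) *ᵗ_) r ≡ map (x *ᵗ_) (map (y *ᵗ_) r)
  eq = trans (map-cong (*ᵗ-assoc x y) r) (map-∘ r)

*-assoc-≡ : ∀ p r s → (p * r) * s ≡ p * (r * s)
*-assoc-≡ []      r s = refl
*-assoc-≡ (x ∷ p) r s = trans (*-distribʳ-≡ s (map (x *ᵗ_) r) (p * r)) (cong₂ _++_ (map-*ᵗ-* x r s) (*-assoc-≡ p r s))

*-identityˡ-≡ : ∀ p → 1# * p ≡ p
*-identityˡ-≡ p = trans (++-identityʳ _) (go p)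
  where
  go : ∀ p → map (term 1ℤ 0ℤ 0ℤ *ᵗ_) p ≡ p
  go []               = refl
  go (term c a b ∷ p)
    rewrite ℤₚ.*-identityˡ c | ℤₚ.+-identityˡ a | ℤₚ.+-identityˡ b = cong (_ ∷_) (go p)

laurentSemiring : CommutativeSemiring 0ℓ 0ℓ
laurentSemiring = record
  { Carrier = Laurent
  ; _≈_ = _≋_
  ; _+_ = _+_
  ; _*_ = _*_
  ; 0#  = 0#
  ; 1#  = 1#
  ; isCommutativeSemiring = isCommutativeSemiringˡ record
    { +-isCommutativeMonoid = record
      { isMonoid = record
        { isSemigroup = record
          { isMagma = record
            { isEquivalence = ≋-isEquivalence
            ; ∙-cong = +-cong
            }
          ; assoc = λ p r s → ≡⇒≋ (++-assoc p r s)
          }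
        ; identity = (λ _ → ≡⇒≋ refl) , λ p → ≡⇒≋ (++-identityʳ p)
        }
      ; comm = +-comm
      }
    ; *-isCommutativeMonoid = record
      { isMonoid = record
        { isSemigroup = record
          { isMagma = record
            { isEquivalence = ≋-isEquivalence
            ; ∙-cong = λ {p} {p′} {r} {r′} e f → ≋-trans (*-congˡ p f)
                (≋-trans (*-comm p r′) (≋-trans (*-congˡ r′ e) (*-comm r′ p′)))
            }
          ; assoc = λ p r s → ≡⇒≋ (*-assoc-≡ p r s)
          }
        ; identity = (λ p → ≡⇒≋ (*-identityˡ-≡ p)) , λ p → ≋-trans (*-comm p 1#) (≡⇒≋ (*-identityˡ-≡ p))
        }
      ; comm = *-comm
      }
    ; distribʳ = λ s p r → ≡⇒≋ (*-distribʳ-≡ s p r)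
    ; zeroˡ = λ _ → ≡⇒≋ refl
    }
  }
  where
  open Biased _≋_ using (isCommutativeSemiringˡ)
  ≋-isEquivalence : IsEquivalence _≋_
  ≋-isEquivalence = record { refl = ≡⇒≋ refl ; sym = ≋-sym ; trans = ≋-trans }

open CommutativeSemiring laurentSemiring
  using ( setoid; +-congˡ; +-congʳ; +-assoc; +-identityʳ
        ; *-cong; *-congʳ; *-assoc; *-identityˡ; *-identityʳ; distribˡ; zeroʳ)
  renaming (refl to ≋-refl)
import Relation.Binary.Reasoning.Setoid setoid as ≋-Reasoning
open import Algebra.Solver.Ring.NaturalCoefficients.Default laurentSemiring
  using (solve; _:=_; _:+_; _:*_)

-- Finite sums

∑-cong : ∀ (xs : List X) {f g : X → Laurent} → (∀ {x} → x ∈ˡ xs → f x ≋ g x) → ∑ xs f ≋ ∑ xs g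
∑-cong []       e = ≋-refl
∑-cong (x ∷ xs) e = +-cong (e (here refl)) (∑-cong xs (e ∘ there))

∑-++ : ∀ (xs ys : List X) f → ∑ (xs ++ ys) f ≋ ∑ xs f + ∑ ys f
∑-++ []       ys f = ≋-refl
∑-++ (x ∷ xs) ys f = ≋-trans (+-congˡ {f x} (∑-++ xs ys f)) (≋-sym (+-assoc (f x) _ _))

∑-map : ∀ (h : X → Y) xs f → ∑ (map h xs) f ≡ ∑ xs (f ∘ h)
∑-map h []       f = refl
∑-map h (x ∷ xs) f = cong (f (h x) ++_) (∑-map h xs f)

∑-concatMap : ∀ (h : X → List Y) xs f → ∑ (concatMap h xs) f ≋ ∑ xs (λ x → ∑ (h x) f)
∑-concatMap h []       f = ≋-refl
∑-concatMap h (x ∷ xs) f = ≋-trans (∑-++ (h x) _ f) (+-congˡ {∑ (h x) f} (∑-concatMap h xs f))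

∑-+ : ∀ (xs : List X) f g → ∑ xs (λ x → f x + g x) ≋ ∑ xs f + ∑ xs g
∑-+ []       f g = ≋-refl
∑-+ (x ∷ xs) f g = ≋-trans (+-congˡ {f x + g x} (∑-+ xs f g))
  (solve 4 (λ a b c d → (a :+ b) :+ (c :+ d) := (a :+ c) :+ (b :+ d)) ≋-refl (f x) (g x) (∑ xs f) (∑ xs g))

∑-*ˡ : ∀ (xs : List X) c f → ∑ xs (λ x → c * f x) ≋ c * ∑ xs f
∑-*ˡ []       c f = ≋-sym (zeroʳ c)
∑-*ˡ (x ∷ xs) c f = ≋-trans (+-congˡ {c * f x} (∑-*ˡ xs c f)) (≋-sym (distribˡ c (f x) _))

∑-0 : ∀ (xs : List X) → ∑ xs (λ _ → 0#) ≡ 0#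
∑-0 []       = refl
∑-0 (x ∷ xs) = ∑-0 xs

∑-swap : ∀ (xs : List X) (ys : List Y) (f : X → Y → Laurent) →
  ∑ xs (λ x → ∑ ys (f x)) ≋ ∑ ys (λ y → ∑ xs (λ x → f x y))
∑-swap []       ys f = ≡⇒≋ (sym (∑-0 ys))
∑-swap (x ∷ xs) ys f = ≋-trans (+-congˡ {∑ ys (f x)} (∑-swap xs ys f)) (≋-sym (∑-+ ys (f x) _))

∑-↭ : ∀ {xs ys : List X} f → xs ↭ ys → ∑ xs f ≋ ∑ ys f
∑-↭ f ↭.refl         = ≋-refl
∑-↭ f (prep x e)     = +-congˡ {f x} (∑-↭ f e)
∑-↭ f (swap x y e)   = ≋-trans (+-congˡ {f x} (+-congˡ {f y} (∑-↭ f e)))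
  (solve 3 (λ a b c → a :+ (b :+ c) := b :+ (a :+ c)) ≋-refl (f x) (f y) _)
∑-↭ f (↭.trans e e′) = ≋-trans (∑-↭ f e) (∑-↭ f e′)

-- q-integers

q↑_ : ℕ → Laurent
q↑ n = q^ (+ n)

[]q-suc : ∀ n → [ suc n ]q ≋ [ n ]q + q↑ n
[]q-suc n = begin
  ∑ (upTo (suc n)) q↑_     ≡⟨ cong (λ xs → ∑ xs q↑_) (upTo-∷ʳ n) ⟨
  ∑ (upTo n ++ [ n ]) q↑_  ≈⟨ ∑-++ (upTo n) [ n ] q↑_ ⟩
  [ n ]q + (q↑ n + 0#)     ≈⟨ +-congˡ {[ n ]q} (+-identityʳ (q↑ n)) ⟩
  [ n ]q + q↑ n            ∎
  where open ≋-Reasoning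

[]q-+ : ∀ m n → [ m ℕ.+ n ]q ≋ [ m ]q + q↑ m * [ n ]q
[]q-+ m zero rewrite ℕₚ.+-identityʳ m = ≋-sym (≋-trans (+-congˡ {[ m ]q} (zeroʳ (q↑ m))) (+-identityʳ _))
[]q-+ m (suc n) = begin
  [ m ℕ.+ suc n ]q                          ≡⟨ cong [_]q (ℕₚ.+-suc m n) ⟩
  [ suc (m ℕ.+ n) ]q                        ≈⟨ []q-suc (m ℕ.+ n) ⟩
  [ m ℕ.+ n ]q + q↑ (m ℕ.+ n)               ≈⟨ +-congʳ {q↑ (m ℕ.+ n)} ([]q-+ m n) ⟩
  -- Exponents of powers of q add by computation, so `q↑ (m ℕ.+ n)` is already `q↑ m * q↑ n`.
  [ m ]q + q↑ m * [ n ]q + q↑ m * q↑ n      ≈⟨ solve 4 (λ a b c d → (a :+ b :* c) :+ b :* d := a :+ b :* (c :+ d)) ≋-refl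
                                                 [ m ]q (q↑ m) [ n ]q (q↑ n) ⟩
  [ m ]q + q↑ m * ([ n ]q + q↑ n)           ≈⟨ +-congˡ {[ m ]q} (*-congˡ (q↑ m) ([]q-suc n)) ⟨
  [ m ]q + q↑ m * [ suc n ]q                ∎
  where open ≋-Reasoning

-- Sums over subsets of a given size

δ : ℕ → ℕ → Laurent
δ zero    zero    = 1#
δ zero    (suc _) = 0#
δ (suc _) zero    = 0#
δ (suc a) (suc b) = δ a b

-- Off the diagonal the factor is zero, so in a sum over `S` the equation for the size of `S` may be
-- assumed.
δ-cong : ∀ a b {p r} → (a ≡ b → p ≋ r) → δ a b * p ≋ δ a b * r
δ-cong zero    zero    e = *-congˡ 1# (e refl)
δ-cong zero    (suc _) e = ≋-refl
δ-cong (suc _) zero    e = ≋-refl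
δ-cong (suc a) (suc b) e = δ-cong a b (e ∘ cong suc)

δ-< : ∀ {a b} → a < b → δ a b ≡ 0#
δ-< {zero}  {suc b} _         = refl
δ-< {suc a} {suc b} (s≤s a<b) = δ-< a<b

-- The size is prescribed by an indicator factor instead of a filtered list. Linearity and exchange
-- of sums are then those of `∑`, and as `δ (suc a) (suc b)` reduces to `δ a b`, removing an element
-- of `S` lowers `k` by computation.
∑ₛ : (n : ℕ) → ℕ → (Subset n → Laurent) → Laurent
∑ₛ n k f = ∑ (allSubsets n) λ S → δ ∣ S ∣ k * f S

∑-upTo-suc : ∀ n f → ∑ (upTo (suc n)) f ≡ f 0 + ∑ (upTo n) (f ∘ suc)
∑-upTo-suc n f = cong (f 0 ++_) (trans (cong (λ xs → ∑ xs f) (sym (map-upTo suc n))) (∑-map suc (upTo n) f))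

∑δ : ∀ {a n} → a < n → ∑ (upTo n) (δ a) ≋ 1#
∑δ {zero} {suc n} _ = ≋-trans (≡⇒≋ (∑-upTo-suc n (δ 0))) (≡⇒≋ (cong (1# ++_) (∑-0 (upTo n))))
∑δ {suc a} {suc n} (s≤s a<n) = ≋-trans (≡⇒≋ (∑-upTo-suc n (δ (suc a)))) (∑δ a<n)

∑ₛ-cong : ∀ n k {f g} → (∀ S → ∣ S ∣ ≡ k → f S ≋ g S) → ∑ₛ n k f ≋ ∑ₛ n k g
∑ₛ-cong n k e = ∑-cong (allSubsets n) λ {S} _ → δ-cong ∣ S ∣ k (e S)

∑ₛ-*ˡ : ∀ n k c f → ∑ₛ n k (λ S → c * f S) ≋ c * ∑ₛ n k f
∑ₛ-*ˡ n k c f = ≋-trans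
  (∑-cong (allSubsets n) λ {S} _ → solve 3 (λ a b c → a :* (b :* c) := b :* (a :* c)) ≋-refl (δ ∣ S ∣ k) c (f S))
  (∑-*ˡ (allSubsets n) c _)

∑ₛ-> : ∀ {n k} f → n < k → ∑ₛ n k f ≋ 0#
∑ₛ-> {n} {k} f n<k = ≋-trans
  (∑-cong (allSubsets n) λ {S} _ → ≡⇒≋ (cong (_* f S) (δ-< (ℕₚ.≤-<-trans (∣p∣≤n S) n<k))))
  (≡⇒≋ (∑-0 (allSubsets n)))

∑-allSubsets-∷ : ∀ n f →
  ∑ (allSubsets (suc n)) f ≋ ∑ (allSubsets n) (f ∘ (inside ∷_)) + ∑ (allSubsets n) (f ∘ (outside ∷_))
∑-allSubsets-∷ n f = begin
  ∑ (map (inside ∷_) A′ ++ map (outside ∷_) A′ ++ []) f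
    ≈⟨ ∑-++ (map (inside ∷_) A′) _ f ⟩
  ∑ (map (inside ∷_) A′) f + ∑ (map (outside ∷_) A′ ++ []) f
    ≈⟨ +-congˡ {∑ (map (inside ∷_) A′) f} (∑-++ (map (outside ∷_) A′) [] f) ⟩
  ∑ (map (inside ∷_) A′) f + (∑ (map (outside ∷_) A′) f + 0#)
    ≈⟨ +-congˡ {∑ (map (inside ∷_) A′) f} (+-identityʳ _) ⟩
  ∑ (map (inside ∷_) A′) f + ∑ (map (outside ∷_) A′) f
    ≡⟨ cong₂ _+_ (∑-map (inside ∷_) A′ f) (∑-map (outside ∷_) A′ f) ⟩
  ∑ A′ (f ∘ (inside ∷_)) + ∑ A′ (f ∘ (outside ∷_)) ∎
  where
  open ≋-Reasoning
  A′ = allSubsets n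

-- `allSubsets` branches on the first position, whereas the recurrences below remove the last one.
-- Splitting off the first position on both sides leaves the induction hypothesis and an exchange of
-- the two middle sums.
∑-allSubsets-∷ʳ : ∀ n f →
  ∑ (allSubsets (suc n)) f ≋ ∑ (allSubsets n) (f ∘ (_∷ʳ inside)) + ∑ (allSubsets n) (f ∘ (_∷ʳ outside))
∑-allSubsets-∷ʳ zero    f = ∑-allSubsets-∷ zero f
∑-allSubsets-∷ʳ (suc n) f = begin
  ∑ (allSubsets (suc (suc n))) f
    ≈⟨ ∑-allSubsets-∷ (suc n) f ⟩
  ∑ (allSubsets (suc n)) (f ∘ (inside ∷_)) + ∑ (allSubsets (suc n)) (f ∘ (outside ∷_))
    ≈⟨ +-cong (∑-allSubsets-∷ʳ n (f ∘ (inside ∷_))) (∑-allSubsets-∷ʳ n (f ∘ (outside ∷_))) ⟩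
  (s inside inside + s inside outside) + (s outside inside + s outside outside)
    ≈⟨ solve 4 (λ a b c d → (a :+ b) :+ (c :+ d) := (a :+ c) :+ (b :+ d)) ≋-refl
         (s inside inside) (s inside outside) (s outside inside) (s outside outside) ⟩
  (s inside inside + s outside inside) + (s inside outside + s outside outside)
    ≈⟨ +-cong (∑-allSubsets-∷ n (f ∘ (_∷ʳ inside))) (∑-allSubsets-∷ n (f ∘ (_∷ʳ outside))) ⟨
  ∑ (allSubsets (suc n)) (f ∘ (_∷ʳ inside)) + ∑ (allSubsets (suc n)) (f ∘ (_∷ʳ outside)) ∎
  where
  open ≋-Reasoning
  s = λ a b → ∑ (allSubsets n) (λ S → f (a ∷ (S ∷ʳ b)))

∣∷ʳinside∣ : ∀ {n} (S : Subset n) → ∣ S ∷ʳ inside ∣ ≡ suc ∣ S ∣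
∣∷ʳinside∣ []            = refl
∣∷ʳinside∣ (inside  ∷ S) = cong suc (∣∷ʳinside∣ S)
∣∷ʳinside∣ (outside ∷ S) = ∣∷ʳinside∣ S

∣∷ʳoutside∣ : ∀ {n} (S : Subset n) → ∣ S ∷ʳ outside ∣ ≡ ∣ S ∣
∣∷ʳoutside∣ []            = refl
∣∷ʳoutside∣ (inside  ∷ S) = cong suc (∣∷ʳoutside∣ S)
∣∷ʳoutside∣ (outside ∷ S) = ∣∷ʳoutside∣ S

∑ₛ-∷ʳ-zero : ∀ n f → ∑ₛ (suc n) 0 f ≋ ∑ₛ n 0 (f ∘ (_∷ʳ outside))
∑ₛ-∷ʳ-zero n f = ≋-trans (∑-allSubsets-∷ʳ n _) (+-cong
  (≋-trans (∑-cong (allSubsets n) λ {S} _ → ≡⇒≋ (cong (λ a → δ a 0 * f (S ∷ʳ inside)) (∣∷ʳinside∣ S)))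
           (≡⇒≋ (∑-0 (allSubsets n))))
  (∑-cong (allSubsets n) λ {S} _ → ≡⇒≋ (cong (λ a → δ a 0 * f (S ∷ʳ outside)) (∣∷ʳoutside∣ S))))

-- The analogue of Pascal's rule: the last position lies in `S` or it does not.
∑ₛ-∷ʳ-suc : ∀ n k f →
  ∑ₛ (suc n) (suc k) f ≋ ∑ₛ n k (f ∘ (_∷ʳ inside)) + ∑ₛ n (suc k) (f ∘ (_∷ʳ outside))
∑ₛ-∷ʳ-suc n k f = ≋-trans (∑-allSubsets-∷ʳ n _) (+-cong
  (∑-cong (allSubsets n) λ {S} _ → ≡⇒≋ (cong (λ a → δ a (suc k) * f (S ∷ʳ inside)) (∣∷ʳinside∣ S)))
  (∑-cong (allSubsets n) λ {S} _ → ≡⇒≋ (cong (λ a → δ a (suc k) * f (S ∷ʳ outside)) (∣∷ʳoutside∣ S))))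

-- The major index of words of natural numbers

majFrom : ∀ {n} → ℕ → Vec ℕ n → ℕ
majFrom p []          = 0
majFrom p (x ∷ [])    = 0
majFrom p (x ∷ y ∷ u) = (if y <ᵇ x then p else 0) ℕ.+ majFrom (suc p) (y ∷ u)

-- Appending `y` creates a single new adjacent pair, whose first letter `x` has position `p + n`
-- when positions are counted from `p`.
majFrom-∷ʳ-∷ʳ : ∀ {n} p (u : Vec ℕ n) x y →
  majFrom p (u ∷ʳ x ∷ʳ y) ≡ (if y <ᵇ x then p ℕ.+ n else 0) ℕ.+ majFrom p (u ∷ʳ x)
majFrom-∷ʳ-∷ʳ p [] x y rewrite ℕₚ.+-identityʳ p = refl
majFrom-∷ʳ-∷ʳ {suc n} p (a ∷ []) x y rewrite ℕₚ.+-suc p 0 | ℕₚ.+-identityʳ p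
  = x∙yz≈y∙xz (if x <ᵇ a then p else 0) (if y <ᵇ x then _ else 0) 0
  where open CommutativeSemigroup ℕₚ.+-commutativeSemigroup using (x∙yz≈y∙xz)
majFrom-∷ʳ-∷ʳ {suc n} p (a ∷ b ∷ u) x y rewrite majFrom-∷ʳ-∷ʳ (suc p) (b ∷ u) x y | ℕₚ.+-suc p n
  = x∙yz≈y∙xz (if b <ᵇ a then p else 0) (if y <ᵇ x then _ else 0) _
  where open CommutativeSemigroup ℕₚ.+-commutativeSemigroup using (x∙yz≈y∙xz)

-- Inserting zeros into a word

-- The word is an infinite sequence whose first `∣ S ∣` letters are used. One `w` thus serves
-- subsets of all sizes, and inductions can pass from one prefix to the next.
insertZeros : ∀ {n} → (ℕ → ℕ) → Subset n → Vec ℕ n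
insertZeros w []            = []
insertZeros w (inside  ∷ S) = w 0 ∷ insertZeros (w ∘ suc) S
insertZeros w (outside ∷ S) = 0 ∷ insertZeros w S

insertZeros-∷ʳinside : ∀ {n} w (S : Subset n) → insertZeros w (S ∷ʳ inside) ≡ insertZeros w S ∷ʳ w ∣ S ∣
insertZeros-∷ʳinside w []            = refl
insertZeros-∷ʳinside w (inside  ∷ S) = cong (w 0 ∷_) (insertZeros-∷ʳinside (w ∘ suc) S)
insertZeros-∷ʳinside w (outside ∷ S) = cong (0 ∷_) (insertZeros-∷ʳinside w S)

insertZeros-∷ʳoutside : ∀ {n} w (S : Subset n) → insertZeros w (S ∷ʳ outside) ≡ insertZeros w S ∷ʳ 0
insertZeros-∷ʳoutside w []            = refl
insertZeros-∷ʳoutside w (inside  ∷ S) = cong (w 0 ∷_) (insertZeros-∷ʳoutside (w ∘ suc) S)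
insertZeros-∷ʳoutside w (outside ∷ S) = cong (0 ∷_) (insertZeros-∷ʳoutside w S)

⊤-∷ʳ : ∀ k → ⊤ {suc k} ≡ ⊤ {k} ∷ʳ inside
⊤-∷ʳ zero    = refl
⊤-∷ʳ (suc k) = cong (inside ∷_) (⊤-∷ʳ k)

if-q↑ : ∀ (b : Bool) p r → q↑ ((if b then p else 0) ℕ.+ r) ≡ (if b then q↑ p else 1#) * q↑ r
if-q↑ true  p r = refl
if-q↑ false p r = refl

module ZeroInsertion (w : ℕ → ℕ) (w-positive : ∀ i → (0 <ᵇ w i) ≡ true) where

  prefix : ∀ k → Vec ℕ k
  prefix k = insertZeros w (⊤ {k})

  prefix-suc : ∀ k → prefix (suc k) ≡ prefix k ∷ʳ w k
  prefix-suc k = trans (cong (insertZeros w) (⊤-∷ʳ k))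
    (trans (insertZeros-∷ʳinside w (⊤ {k})) (cong (λ j → prefix k ∷ʳ w j) (∣⊤∣≡n k)))

  ν : ℕ → ℕ
  ν k = majFrom 1 (prefix k)

  ν-suc-suc : ∀ k → ν (suc (suc k)) ≡ (if w (suc k) <ᵇ w k then suc k else 0) ℕ.+ ν (suc k)
  ν-suc-suc k = begin
    majFrom 1 (prefix (suc (suc k)))            ≡⟨ cong (majFrom 1) (prefix-suc (suc k)) ⟩
    majFrom 1 (prefix (suc k) ∷ʳ w (suc k))     ≡⟨ cong (λ u → majFrom 1 (u ∷ʳ w (suc k))) (prefix-suc k) ⟩
    majFrom 1 (prefix k ∷ʳ w k ∷ʳ w (suc k))    ≡⟨ majFrom-∷ʳ-∷ʳ 1 (prefix k) (w k) (w (suc k)) ⟩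
    d ℕ.+ majFrom 1 (prefix k ∷ʳ w k)           ≡⟨ cong (λ u → d ℕ.+ majFrom 1 u) (prefix-suc k) ⟨
    d ℕ.+ ν (suc k)                             ∎
    where
    open ≡-Reasoning
    d = if w (suc k) <ᵇ w k then suc k else 0

  total : ℕ → ℕ → Laurent
  total n k = ∑ₛ n k λ S → q↑ majFrom 1 (insertZeros w S)

  -- The sums over words of length suc n with k nonzero letters before a last letter 0 or w k.
  endZero endLetter : ℕ → ℕ → Laurent
  endZero   n k = ∑ₛ n k λ S → q↑ majFrom 1 (insertZeros w S ∷ʳ 0)
  endLetter n k = ∑ₛ n k λ S → q↑ majFrom 1 (insertZeros w S ∷ʳ w k)

  total-suc-suc : ∀ n k → total (suc n) (suc k) ≋ endLetter n k + endZero n (suc k)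
  total-suc-suc n k = ≋-trans (∑ₛ-∷ʳ-suc n k _) (+-cong
    (∑ₛ-cong n k λ S e → ≡⇒≋ (cong (q↑_ ∘ majFrom 1)
      (trans (insertZeros-∷ʳinside w S) (cong (λ j → insertZeros w S ∷ʳ w j) e))))
    (∑ₛ-cong n (suc k) λ S _ → ≡⇒≋ (cong (q↑_ ∘ majFrom 1) (insertZeros-∷ʳoutside w S))))

  -- The pair of `0` and `y` is no descent: `y <ᵇ 0` computes to `false`.
  afterZero : ∀ {n} y (S : Subset n) →
    q↑ majFrom 1 (insertZeros w (S ∷ʳ outside) ∷ʳ y) ≋ q↑ majFrom 1 (insertZeros w S ∷ʳ 0)
  afterZero y S = ≡⇒≋ (cong q↑_ (trans (cong (λ u → majFrom 1 (u ∷ʳ y)) (insertZeros-∷ʳoutside w S))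
    (majFrom-∷ʳ-∷ʳ 1 (insertZeros w S) 0 y)))

  -- The size of `S` identifies the letter before `y` as `w k`; its position is `suc n`.
  afterLetter : ∀ {n} k y (S : Subset n) → ∣ S ∣ ≡ k →
    q↑ majFrom 1 (insertZeros w (S ∷ʳ inside) ∷ʳ y) ≋
    (if y <ᵇ w k then q↑ suc n else 1#) * q↑ majFrom 1 (insertZeros w S ∷ʳ w k)
  afterLetter {n} k y S refl = ≡⇒≋ (trans
    (cong q↑_ (trans (cong (λ u → majFrom 1 (u ∷ʳ y)) (insertZeros-∷ʳinside w S))
      (majFrom-∷ʳ-∷ʳ 1 (insertZeros w S) (w k) y)))
    (if-q↑ (y <ᵇ w k) (suc n) (majFrom 1 (insertZeros w S ∷ʳ w k))))

  -- The letter before `y` is `w k` or `0`. Keeping `y` arbitrary yields the recurrence of `endZero`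
  -- at `y = 0` and that of `endLetter` at `y = w (suc k)`.
  end-suc-suc : ∀ n k y → (∑ₛ (suc n) (suc k) λ S → q↑ majFrom 1 (insertZeros w S ∷ʳ y)) ≋
    (if y <ᵇ w k then q↑ suc n else 1#) * endLetter n k + endZero n (suc k)
  end-suc-suc n k y = ≋-trans (∑ₛ-∷ʳ-suc n k _) (+-cong
    (≋-trans (∑ₛ-cong n k (afterLetter k y)) (∑ₛ-*ˡ n k (if y <ᵇ w k then q↑ suc n else 1#) _))
    (∑ₛ-cong n (suc k) λ S _ → afterZero y S))

  -- The only word consists of zeros followed by `y` and has no descent.
  end-0 : ∀ n y → (∑ₛ n 0 λ S → q↑ majFrom 1 (insertZeros w S ∷ʳ y)) ≋ 1#
  end-0 zero    y = ≋-refl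
  end-0 (suc n) y = ≋-trans (∑ₛ-∷ʳ-zero n _) (≋-trans (∑ₛ-cong n 0 λ S _ → afterZero y S) (end-0 n 0))

  endZero-suc-suc : ∀ n k → endZero (suc n) (suc k) ≋ q↑ suc n * endLetter n k + endZero n (suc k)
  endZero-suc-suc n k = ≋-trans (end-suc-suc n k 0)
    (≡⇒≋ (cong (λ b → (if b then q↑ suc n else 1#) * endLetter n k + endZero n (suc k)) (w-positive k)))

  -- For m = 0 both sides vanish, the left one because k < suc k.
  endZero-step : ∀ k m →
    endZero (k ℕ.+ m) (suc k) * ([ suc k ]q! * [ m ]q!) ≋ q↑ ν (suc k) * (q↑ suc k * ([ m ]q * [ k ℕ.+ m ]q!))
  -- The four identities share one induction: at fixed `k` the calls descend in `m`, and
  -- `endLetter-[]q!` at `suc k` uses identities at `k` only. Read as a quotient, this one says that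
  -- `endZero` is q to the power `ν (suc k) + suc k` times the q-binomial coefficient of `suc k + m`
  -- over `m`.
  endZero-[]q! : ∀ k m →
    endZero (suc k ℕ.+ m) (suc k) * ([ suc k ]q! * [ m ]q!) ≋ q↑ ν (suc k) * (q↑ suc k * [ suc k ℕ.+ m ]q!)
  -- Read as a quotient, the value is `q↑ ν (suc k)` times the q-binomial coefficient of `k + m`
  -- over `m`. The order of the letters of `w` enters only through `ν`.
  endLetter-[]q! : ∀ k m →
    endLetter (k ℕ.+ m) k * ([ k ]q! * [ m ]q!) ≋ q↑ ν (suc k) * [ k ℕ.+ m ]q!
  -- This sum serves twice: it is the recurrence of `endLetter` when there is no descent from `w k`
  -- to `w (suc k)`, and it is `total` split by the last letter.
  end-sum : ∀ k m →
    (endLetter (k ℕ.+ m) k + endZero (k ℕ.+ m) (suc k)) * ([ suc k ]q! * [ m ]q!) ≋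
    q↑ ν (suc k) * [ suc (k ℕ.+ m) ]q!

  endZero-step k zero = begin
    endZero (k ℕ.+ 0) (suc k) * ([ suc k ]q! * 1#)
      ≈⟨ *-congʳ {[ suc k ]q! * 1#} (∑ₛ-> {k ℕ.+ 0} {suc k} _ (s≤s (ℕₚ.≤-reflexive (ℕₚ.+-identityʳ k)))) ⟩
    0#
      ≈⟨ zeroʳ (q↑ ν (suc k) * q↑ suc k) ⟨
    q↑ ν (suc k) * q↑ suc k * 0#
      ≈⟨ *-assoc (q↑ ν (suc k)) (q↑ suc k) 0# ⟩
    q↑ ν (suc k) * (q↑ suc k * 0#) ∎
    where open ≋-Reasoning
  -- As `k + suc m = suc k + m`, this is `endZero-[]q! k m` multiplied by `[ suc m ]q`.
  endZero-step k (suc m) = subst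
    (λ n → endZero n (suc k) * ([ suc k ]q! * [ suc m ]q!) ≋ q↑ ν (suc k) * (q↑ suc k * ([ suc m ]q * [ n ]q!)))
    (sym (ℕₚ.+-suc k m))
    (begin
      E * (f * (g * b))  ≈⟨ solve 4 (λ E f g b → E :* (f :* (g :* b)) := (E :* (f :* g)) :* b) ≋-refl E f g b ⟩
      E * (f * g) * b    ≈⟨ *-congʳ {b} (endZero-[]q! k m) ⟩
      x * (y * h) * b    ≈⟨ solve 4 (λ x y h b → (x :* (y :* h)) :* b := x :* (y :* (b :* h))) ≋-refl x y h b ⟩
      x * (y * (b * h))  ∎)
    where
    open ≋-Reasoning
    E = endZero (suc k ℕ.+ m) (suc k)
    f = [ suc k ]q!
    g = [ m ]q!
    b = [ suc m ]q
    x = q↑ ν (suc k)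
    y = q↑ suc k
    h = [ suc k ℕ.+ m ]q!

  endZero-[]q! k m = begin
    endZero (suc (k ℕ.+ m)) (suc k) * (f * b * g)
      ≈⟨ *-congʳ {f * b * g} (endZero-suc-suc (k ℕ.+ m) k) ⟩
    -- The descent to the final zero gives `q↑ suc (k ℕ.+ m)`, which is `y * z` by computation.
    (y * z * L + E) * (f * b * g)
      ≈⟨ solve 7 (λ y z L E f b g → (y :* z :* L :+ E) :* (f :* b :* g) :=
                    y :* z :* b :* (L :* (f :* g)) :+ E :* (f :* b :* g)) ≋-refl y z L E f b g ⟩
    y * z * b * (L * (f * g)) + E * (f * b * g)
      ≈⟨ +-cong (*-congˡ (y * z * b) (endLetter-[]q! k m)) (endZero-step k m) ⟩
    y * z * b * (x * h) + x * (y * (c * h))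
      ≈⟨ solve 6 (λ x y z b c h → y :* z :* b :* (x :* h) :+ x :* (y :* (c :* h)) :=
                    x :* (y :* (h :* (c :+ z :* b)))) ≋-refl x y z b c h ⟩
    x * (y * (h * (c + z * b)))
      ≈⟨ *-congˡ x (*-congˡ y (*-congˡ h ([]q-+ m (suc k)))) ⟨
    x * (y * (h * [ m ℕ.+ suc k ]q))
      ≡⟨ cong (λ n → x * (y * (h * [ n ]q))) (ℕₚ.+-comm m (suc k)) ⟩
    x * (y * (h * [ suc (k ℕ.+ m) ]q)) ∎
    where
    open ≋-Reasoning
    E = endZero (k ℕ.+ m) (suc k)
    L = endLetter (k ℕ.+ m) k
    f = [ k ]q!
    g = [ m ]q!
    b = [ suc k ]q
    c = [ m ]q
    x = q↑ ν (suc k)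
    y = q↑ suc k
    z = q↑ m
    h = [ k ℕ.+ m ]q!

  -- `ν 1` computes to 0, so the right-hand side is `1# * [ m ]q!`.
  endLetter-[]q! zero m = begin
    endLetter m 0 * (1# * [ m ]q!)  ≈⟨ *-congʳ {1# * [ m ]q!} (end-0 m (w 0)) ⟩
    1# * (1# * [ m ]q!)             ≈⟨ *-congˡ 1# (*-identityˡ [ m ]q!) ⟩
    1# * [ m ]q!                    ∎
    where open ≋-Reasoning
  -- The recurrences of `endLetter` and `ν` are abstracted together with the comparison, so that
  -- both are evaluated at the same outcome.
  endLetter-[]q! (suc k) m with w (suc k) <ᵇ w k | end-suc-suc (k ℕ.+ m) k (w (suc k)) | ν-suc-suc k
  -- A descent from w k has the same effect as a descent to a final 0.
  ... | true  | e | d = begin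
    endLetter (suc (k ℕ.+ m)) (suc k) * ([ suc k ]q! * [ m ]q!)
      ≈⟨ *-congʳ {[ suc k ]q! * [ m ]q!} (≋-trans e (≋-sym (endZero-suc-suc (k ℕ.+ m) k))) ⟩
    endZero (suc (k ℕ.+ m)) (suc k) * ([ suc k ]q! * [ m ]q!)
      ≈⟨ endZero-[]q! k m ⟩
    q↑ ν (suc k) * (q↑ suc k * [ suc k ℕ.+ m ]q!)
      ≈⟨ solve 3 (λ x y h → x :* (y :* h) := y :* x :* h) ≋-refl (q↑ ν (suc k)) (q↑ suc k) [ suc k ℕ.+ m ]q! ⟩
    q↑ (suc k ℕ.+ ν (suc k)) * [ suc k ℕ.+ m ]q!
      ≡⟨ cong (λ n → q↑ n * [ suc k ℕ.+ m ]q!) d ⟨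
    q↑ ν (suc (suc k)) * [ suc k ℕ.+ m ]q! ∎
    where open ≋-Reasoning
  -- Without a descent `ν` keeps its value and the coefficient of `endLetter` is 1, which leaves the
  -- sum in `end-sum`.
  ... | false | e | d = begin
    endLetter (suc (k ℕ.+ m)) (suc k) * ([ suc k ]q! * [ m ]q!)
      ≈⟨ *-congʳ {[ suc k ]q! * [ m ]q!} e ⟩
    (1# * endLetter (k ℕ.+ m) k + endZero (k ℕ.+ m) (suc k)) * ([ suc k ]q! * [ m ]q!)
      ≈⟨ *-congʳ {[ suc k ]q! * [ m ]q!} (+-congʳ {endZero (k ℕ.+ m) (suc k)} (*-identityˡ (endLetter (k ℕ.+ m) k))) ⟩
    (endLetter (k ℕ.+ m) k + endZero (k ℕ.+ m) (suc k)) * ([ suc k ]q! * [ m ]q!)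
      ≈⟨ end-sum k m ⟩
    q↑ ν (suc k) * [ suc (k ℕ.+ m) ]q!
      ≡⟨ cong (λ n → q↑ n * [ suc k ℕ.+ m ]q!) d ⟨
    q↑ ν (suc (suc k)) * [ suc k ℕ.+ m ]q! ∎
    where open ≋-Reasoning

  end-sum k m = begin
    (L + E) * (f * b * g)
      ≈⟨ solve 5 (λ L E f b g → (L :+ E) :* (f :* b :* g) :=
                    b :* (L :* (f :* g)) :+ E :* (f :* b :* g)) ≋-refl L E f b g ⟩
    b * (L * (f * g)) + E * (f * b * g)
      ≈⟨ +-cong (*-congˡ b (endLetter-[]q! k m)) (endZero-step k m) ⟩
    b * (x * h) + x * (y * (c * h))
      ≈⟨ solve 5 (λ x y b c h → b :* (x :* h) :+ x :* (y :* (c :* h)) :=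
                    x :* (h :* (b :+ y :* c))) ≋-refl x y b c h ⟩
    x * (h * (b + y * c))
      ≈⟨ *-congˡ x (*-congˡ h ([]q-+ (suc k) m)) ⟨
    x * (h * [ suc (k ℕ.+ m) ]q) ∎
    where
    open ≋-Reasoning
    E = endZero (k ℕ.+ m) (suc k)
    L = endLetter (k ℕ.+ m) k
    f = [ k ]q!
    g = [ m ]q!
    b = [ suc k ]q
    c = [ m ]q
    x = q↑ ν (suc k)
    y = q↑ suc k
    h = [ k ℕ.+ m ]q!

  total-[]q! : ∀ k m → total (suc k ℕ.+ m) (suc k) * ([ suc k ]q! * [ m ]q!) ≋ q↑ ν (suc k) * [ suc k ℕ.+ m ]q!
  total-[]q! k m = ≋-trans (*-congʳ {[ suc k ]q! * [ m ]q!} (total-suc-suc (k ℕ.+ m) k)) (end-sum k m)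

-- Decorated permutations from permutations

-- The increasing bijection onto `S`.
embed : ∀ {n} (S : Subset n) → Fin ∣ S ∣ → Fin n
embed (inside  ∷ S) zero    = zero
embed (inside  ∷ S) (suc j) = suc (embed S j)
embed (outside ∷ S) j       = suc (embed S j)

scatter : ∀ {n} → X → (S : Subset n) → Vec X ∣ S ∣ → Vec X n
scatter z []            []      = []
scatter z (inside  ∷ S) (x ∷ u) = x ∷ scatter z S u
scatter z (outside ∷ S) u       = z ∷ scatter z S u

relabel : ∀ {n} (S : Subset n) → Fin (suc ∣ S ∣) → Fin (suc n)
relabel S zero    = zero
relabel S (suc v) = suc (embed S v)

-- Conjugation of `π` by `embed S`: `scatter` transports the positions and `relabel` the letters,
-- with `0` off `S`.
spread : ∀ {n} (S : Subset n) → Word ∣ S ∣ → Word n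
spread S π = Vec.map (relabel S) (scatter zero S π)

embed-∈ : ∀ {n} (S : Subset n) j → embed S j ∈ S
embed-∈ (inside  ∷ S) zero    = here
embed-∈ (inside  ∷ S) (suc j) = there (embed-∈ S j)
embed-∈ (outside ∷ S) j       = there (embed-∈ S j)

∈⇒embed : ∀ {n} {S : Subset n} {i} → i ∈ S → ∃ λ j → embed S j ≡ i
∈⇒embed {S = inside ∷ S}  here        = zero , refl
∈⇒embed {S = inside ∷ S}  (there i∈S) = let j , e = ∈⇒embed i∈S in suc j , cong suc e
∈⇒embed {S = outside ∷ S} (there i∈S) = let j , e = ∈⇒embed i∈S in j , cong suc e

embed-injective : ∀ {n} (S : Subset n) {i j} → embed S i ≡ embed S j → i ≡ j
embed-injective (inside  ∷ S) {zero}  {zero}  e = refl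
embed-injective (inside  ∷ S) {suc i} {suc j} e = cong suc (embed-injective S (suc-injective e))
embed-injective (outside ∷ S)                 e = embed-injective S (suc-injective e)

-- Stated with `_<ᵇ_`, the Boolean test to which the decisions in `exc` and `maj` reduce.
embed-<ᵇ : ∀ {n} (S : Subset n) i j → (toℕ (embed S i) <ᵇ toℕ (embed S j)) ≡ (toℕ i <ᵇ toℕ j)
embed-<ᵇ (inside  ∷ S) zero    zero    = refl
embed-<ᵇ (inside  ∷ S) zero    (suc j) = refl
embed-<ᵇ (inside  ∷ S) (suc i) zero    = refl
embed-<ᵇ (inside  ∷ S) (suc i) (suc j) = embed-<ᵇ S i j
embed-<ᵇ (outside ∷ S) i       j       = embed-<ᵇ S i j

relabel-<ᵇ : ∀ {n} (S : Subset n) x y → (toℕ (relabel S x) <ᵇ toℕ (relabel S y)) ≡ (toℕ x <ᵇ toℕ y)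
relabel-<ᵇ S zero    zero    = refl
relabel-<ᵇ S zero    (suc y) = refl
relabel-<ᵇ S (suc x) zero    = refl
relabel-<ᵇ S (suc x) (suc y) = embed-<ᵇ S x y

relabel-injective : ∀ {n} (S : Subset n) {x y} → relabel S x ≡ relabel S y → x ≡ y
relabel-injective S {zero}  {zero}  e = refl
relabel-injective S {suc x} {suc y} e = cong suc (embed-injective S (suc-injective e))

lookup-scatter-embed : ∀ {n} (z : X) (S : Subset n) u j → lookup (scatter z S u) (embed S j) ≡ lookup u j
lookup-scatter-embed z (inside  ∷ S) (x ∷ u) zero    = refl
lookup-scatter-embed z (inside  ∷ S) (x ∷ u) (suc j) = lookup-scatter-embed z S u j
lookup-scatter-embed z (outside ∷ S) u       j       = lookup-scatter-embed z S u j

lookup-scatter-∉ : ∀ {n} (z : X) (S : Subset n) u {i} → i ∉ S → lookup (scatter z S u) i ≡ z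
lookup-scatter-∉ z (inside  ∷ S) (x ∷ u) {zero}  i∉S = ⊥-elim (i∉S here)
lookup-scatter-∉ z (inside  ∷ S) (x ∷ u) {suc i} i∉S = lookup-scatter-∉ z S u (i∉S ∘ there)
lookup-scatter-∉ z (outside ∷ S) u       {zero}  i∉S = refl
lookup-scatter-∉ z (outside ∷ S) u       {suc i} i∉S = lookup-scatter-∉ z S u (i∉S ∘ there)

lookup-spread-embed : ∀ {n} (S : Subset n) π j → lookup (spread S π) (embed S j) ≡ relabel S (lookup π j)
lookup-spread-embed S π j =
  trans (Vecₚ.lookup-map (embed S j) (relabel S) (scatter zero S π)) (cong (relabel S) (lookup-scatter-embed zero S π j))

lookup-spread-∉ : ∀ {n} (S : Subset n) π {i} → i ∉ S → lookup (spread S π) i ≡ zero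
lookup-spread-∉ S π {i} i∉S =
  trans (Vecₚ.lookup-map i (relabel S) (scatter zero S π)) (cong (relabel S) (lookup-scatter-∉ zero S π i∉S))

lookup-ext : ∀ {n} {u v : Vec X n} → lookup u ≗ lookup v → u ≡ v
lookup-ext {u = u} {v} e = trans (sym (Vecₚ.tabulate∘lookup u)) (trans (Vecₚ.tabulate-cong e) (Vecₚ.tabulate∘lookup v))

spread-injective : ∀ {n} (S : Subset n) {π ρ} → spread S π ≡ spread S ρ → π ≡ ρ
spread-injective S {π} {ρ} e = lookup-ext λ j → relabel-injective S (begin
  relabel S (lookup π j)             ≡⟨ lookup-spread-embed S π j ⟨
  lookup (spread S π) (embed S j)    ≡⟨ cong (λ σ → lookup σ (embed S j)) e ⟩
  lookup (spread S ρ) (embed S j)    ≡⟨ lookup-spread-embed S ρ j ⟩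
  relabel S (lookup ρ j)             ∎)
  where open ≡-Reasoning

spread-isPermutation : ∀ {n} (S : Subset n) {π} → IsPermutationOf ⊤ π → IsPermutationOf S (spread S π)
spread-isPermutation S {π} (_ , closed , inj , surj) =
  (λ i → lookup-spread-∉ S π) , closed′ , inj′ , surj′
  where
  closed′ : ∀ i → i ∈ S → ∃ λ j → j ∈ S × lookup (spread S π) i ≡ suc j
  closed′ _ i∈S with j , refl ← ∈⇒embed i∈S with v , _ , e ← closed j ∈⊤ =
    embed S v , embed-∈ S v , trans (lookup-spread-embed S π j) (cong (relabel S) e)

  inj′ : ∀ i j → i ∈ S → j ∈ S → lookup (spread S π) i ≡ lookup (spread S π) j → i ≡ j
  inj′ _ _ i∈S j∈S e with i , refl ← ∈⇒embed i∈S | j , refl ← ∈⇒embed j∈S =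
    cong (embed S) (inj i j ∈⊤ ∈⊤ (relabel-injective S
      (trans (sym (lookup-spread-embed S π i)) (trans e (lookup-spread-embed S π j)))))

  surj′ : ∀ j → j ∈ S → ∃ λ i → i ∈ S × lookup (spread S π) i ≡ suc j
  surj′ _ j∈S with v , refl ← ∈⇒embed j∈S with i , _ , e ← surj v ∈⊤ =
    embed S i , embed-∈ S i , trans (lookup-spread-embed S π i) (cong (relabel S) e)

-- Conjugating back: `σ` maps `S` into itself, so its letter at `embed S j` is `suc (embed S v)` for
-- some `v`, and these `v` make up `π`.
isPermutation⇒spread : ∀ {n} (S : Subset n) {σ} → IsPermutationOf S σ →
  ∃ λ π → IsPermutationOf ⊤ π × σ ≡ spread S π
isPermutation⇒spread S {σ} (fixed , closed , inj , surj) =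
  π , ((λ i i∉⊤ → ⊥-elim (i∉⊤ ∈⊤)) , closed′ , inj′ , surj′) , lookup-ext σ≗
  where
  preimage : ∀ j → ∃ λ v → suc (embed S v) ≡ lookup σ (embed S j)
  preimage j = let _ , i∈S , e = closed (embed S j) (embed-∈ S j)
                   v , e′ = ∈⇒embed i∈S
               in v , trans (cong suc e′) (sym e)

  π : Word ∣ S ∣
  π = Vec.tabulate (suc ∘ proj₁ ∘ preimage)

  lookup-π : ∀ j → lookup π j ≡ suc (proj₁ (preimage j))
  lookup-π = Vecₚ.lookup∘tabulate (suc ∘ proj₁ ∘ preimage)

  relabel-π : ∀ j → relabel S (lookup π j) ≡ lookup σ (embed S j)
  relabel-π j = trans (cong (relabel S) (lookup-π j)) (proj₂ (preimage j))

  closed′ : ∀ i → i ∈ ⊤ → ∃ λ j → j ∈ ⊤ × lookup π i ≡ suc j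
  closed′ i _ = proj₁ (preimage i) , ∈⊤ , lookup-π i

  inj′ : ∀ i j → i ∈ ⊤ → j ∈ ⊤ → lookup π i ≡ lookup π j → i ≡ j
  inj′ i j _ _ e = embed-injective S (inj _ _ (embed-∈ S i) (embed-∈ S j)
    (trans (sym (relabel-π i)) (trans (cong (relabel S) e) (relabel-π j))))

  surj′ : ∀ j → j ∈ ⊤ → ∃ λ i → i ∈ ⊤ × lookup π i ≡ suc j
  surj′ j _ with _ , i∈S , e ← surj (embed S j) (embed-∈ S j) with i , refl ← ∈⇒embed i∈S =
    i , ∈⊤ , relabel-injective S (trans (relabel-π i) e)

  σ≗ : lookup σ ≗ lookup (spread S π)
  σ≗ i with i ∈? S
  ... | no i∉S = trans (fixed i i∉S) (sym (lookup-spread-∉ S π i∉S))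
  ... | yes i∈S with j , refl ← ∈⇒embed i∈S = sym (trans (lookup-spread-embed S π j) (relabel-π j))

-- Enumerations of permutations

allVecs-unique : ∀ {xs : List X} → Unique xs → ∀ n → Unique (allVecs xs n)
allVecs-unique xs! zero    = [] ∷ []
allVecs-unique xs! (suc n) = Unique.cartesianProductWith⁺ _∷_ Vecₚ.∷-injective xs! (allVecs-unique xs! n)

∈-allVecs : ∀ {xs : List X} → (∀ x → x ∈ˡ xs) → ∀ {n} (u : Vec X n) → u ∈ˡ allVecs xs n
∈-allVecs ∈xs []      = here refl
∈-allVecs ∈xs (x ∷ u) = ∈-cartesianProductWith⁺ _∷_ (∈xs x) (∈-allVecs ∈xs u)

permutationsOf-unique : ∀ {n} (S : Subset n) → Unique (permutationsOf S)
permutationsOf-unique {n} S = Unique.filter⁺ (isPermutationOf? S) (allVecs-unique (Unique.allFin⁺ (suc n)) n)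

∈-permutationsOf : ∀ {n} (S : Subset n) {σ} → IsPermutationOf S σ → σ ∈ˡ permutationsOf S
∈-permutationsOf S {σ} = ∈-filter⁺ (isPermutationOf? S) (∈-allVecs ∈-allFin σ)

∈-permutationsOf⁻ : ∀ {n} (S : Subset n) {σ} → σ ∈ˡ permutationsOf S → IsPermutationOf S σ
∈-permutationsOf⁻ {n} S = proj₂ ∘ ∈-filter⁻ (isPermutationOf? S) {xs = allWords n}

-- Both lists are free of repetitions and have the same members, hence agree up to order. Sums over
-- `permutationsOf S` can then be reindexed.
permutationsOf-↭ : ∀ {n} (S : Subset n) → permutationsOf S ↭ map (spread S) (permutations ∣ S ∣)
permutationsOf-↭ S = ∼bag⇒↭ (unique∧set⇒bag
  (permutationsOf-unique S)
  (Unique.map⁺ (spread-injective S) (permutationsOf-unique ⊤))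
  (mk⇔ to from))
  where
  to : ∀ {σ} → σ ∈ˡ permutationsOf S → σ ∈ˡ map (spread S) (permutations ∣ S ∣)
  to {σ} σ∈ with π , πp , refl ← isPermutation⇒spread S {σ} (∈-permutationsOf⁻ S σ∈) =
    ∈-map⁺ (spread S) (∈-permutationsOf ⊤ {π} πp)
  from : ∀ {σ} → σ ∈ˡ map (spread S) (permutations ∣ S ∣) → σ ∈ˡ permutationsOf S
  from σ∈ with π , π∈ , refl ← ∈-map⁻ (spread S) σ∈ =
    ∈-permutationsOf S {spread S π} (spread-isPermutation S {π} (∈-permutationsOf⁻ ⊤ π∈))

-- Excedances and major index under spreading

count : ∀ {n} → (Fin n → Bool) → ℕ
count {zero}  b = 0
count {suc n} b = (if b zero then 1 else 0) ℕ.+ count (b ∘ suc)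

count-cong : ∀ {n} {b c : Fin n → Bool} → b ≗ c → count b ≡ count c
count-cong {zero}  e = refl
count-cong {suc n} e = cong₂ ℕ._+_ (cong (if_then 1 else 0) (e zero)) (count-cong (e ∘ suc))

count-embed : ∀ {n} (S : Subset n) {b} → (∀ {i} → i ∉ S → b i ≡ false) → count b ≡ count (b ∘ embed S)
count-embed []                    e = refl
count-embed (inside  ∷ S) {b}     e =
  cong ((if b zero then 1 else 0) ℕ.+_) (count-embed S λ i∉S → e λ { (there i∈S) → i∉S i∈S })
count-embed (outside ∷ S) {b}     e rewrite e {zero} (λ ()) =
  count-embed S λ i∉S → e λ { (there i∈S) → i∉S i∈S }

length-filter-tabulate : ∀ {P : Pred X 0ℓ} (P? : Decidable P) {n} (f : Fin n → X) →
  length (filter P? (tabulate f)) ≡ count (does ∘ P? ∘ f)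
length-filter-tabulate P? {zero}  f = refl
length-filter-tabulate P? {suc n} f with does (P? (f zero))
... | false = length-filter-tabulate P? (f ∘ suc)
... | true  = cong suc (length-filter-tabulate P? (f ∘ suc))

exc≡count : ∀ {n} (w : Word n) → exc w ≡ count (λ i → suc (toℕ i) <ᵇ toℕ (lookup w i))
exc≡count w = length-filter-tabulate (λ i → suc i <ᶠ? lookup w i) (λ i → i)

-- Positions off `S` hold `0` and are no excedances; on `S` the increasing relabelling preserves the
-- comparison of a position with its letter.
exc-spread : ∀ {n} (S : Subset n) π → exc (spread S π) ≡ exc π
exc-spread S π = begin
  exc (spread S π)                  ≡⟨ exc≡count (spread S π) ⟩
  count b                           ≡⟨ count-embed S (λ {i} i∉S → cong (λ x → suc (toℕ i) <ᵇ toℕ x) (lookup-spread-∉ S π i∉S)) ⟩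
  count (b ∘ embed S)               ≡⟨ count-cong (λ j → trans
                                         (cong (λ x → suc (toℕ (embed S j)) <ᵇ toℕ x) (lookup-spread-embed S π j))
                                         -- The position `j` is treated as the letter `suc j`, so
                                         -- that `relabel S` acts on both sides of the comparison.
                                         (relabel-<ᵇ S (suc j) (lookup π j))) ⟩
  count (λ j → suc (toℕ j) <ᵇ toℕ (lookup π j))  ≡⟨ exc≡count π ⟨
  exc π                             ∎
  where
  open ≡-Reasoning
  b = λ i → suc (toℕ i) <ᵇ toℕ (lookup (spread S π) i)

weightFrom : ∀ {n} → ℕ → (Fin n → Bool) → ℕ
weightFrom {zero}  p b = 0
weightFrom {suc n} p b = (if b zero then p else 0) ℕ.+ weightFrom (suc p) (b ∘ suc)

-- The offset `p` and the function `f` are general because passing to the tail of `tabulate` shifts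
-- both.
sum-filter-tabulate : ∀ {P : Pred X 0ℓ} (P? : Decidable P) h p {n} (f : Fin n → X) →
  (∀ i → h (f i) ≡ p ℕ.+ toℕ i) → sum (map h (filter P? (tabulate f))) ≡ weightFrom p (does ∘ P? ∘ f)
sum-filter-tabulate P? h p {zero}  f e = refl
sum-filter-tabulate P? h p {suc n} f e
  with does (P? (f zero)) | sum-filter-tabulate P? h (suc p) (f ∘ suc) (λ i → trans (e (suc i)) (ℕₚ.+-suc p (toℕ i)))
... | false | ih = ih
... | true  | ih = cong₂ ℕ._+_ (trans (e zero) (ℕₚ.+-identityʳ p)) ih

weightFrom-descents : ∀ {n N} p (w : Vec (Fin N) (suc n)) →
  weightFrom p (λ i → toℕ (lookup w (suc i)) <ᵇ toℕ (lookup w (inject₁ i))) ≡ majFrom p (Vec.map toℕ w)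
weightFrom-descents p (x ∷ [])    = refl
weightFrom-descents p (x ∷ y ∷ w) =
  cong ((if toℕ y <ᵇ toℕ x then p else 0) ℕ.+_) (weightFrom-descents (suc p) (y ∷ w))

maj≡majFrom : ∀ {n} (w : Word n) → maj w ≡ majFrom 1 (Vec.map toℕ w)
maj≡majFrom {zero}  []  = refl
maj≡majFrom {suc n} w = trans
  (sum-filter-tabulate (λ i → lookup w (suc i) <ᶠ? lookup w (inject₁ i)) (suc ∘ toℕ) 1 (λ i → i) (λ _ → refl))
  (weightFrom-descents 1 w)

majFrom-map-cong : ∀ {f g : X → ℕ} → (∀ x y → (f x <ᵇ f y) ≡ (g x <ᵇ g y)) →
  ∀ {n} p (u : Vec X n) → majFrom p (Vec.map f u) ≡ majFrom p (Vec.map g u)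
majFrom-map-cong e p []          = refl
majFrom-map-cong e p (x ∷ [])    = refl
majFrom-map-cong e p (x ∷ y ∷ u) =
  cong₂ ℕ._+_ (cong (if_then p else 0) (e y x)) (majFrom-map-cong e (suc p) (y ∷ u))

map-scatter : ∀ (f : X → Y) z {n} (S : Subset n) u → Vec.map f (scatter z S u) ≡ scatter (f z) S (Vec.map f u)
map-scatter f z []            []      = refl
map-scatter f z (inside  ∷ S) (x ∷ u) = cong (f x ∷_) (map-scatter f z S u)
map-scatter f z (outside ∷ S) u       = cong (f z ∷_) (map-scatter f z S u)

-- Continued by 1, so that all letters stay positive.
letter : ∀ {k} → Vec ℕ k → ℕ → ℕ
letter []      i       = 1
letter (x ∷ u) zero    = x
letter (x ∷ u) (suc i) = letter u i

letter-positive : ∀ {k} (u : Vec ℕ k) → (∀ j → (0 <ᵇ lookup u j) ≡ true) → ∀ i → (0 <ᵇ letter u i) ≡ true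
letter-positive []      e i       = refl
letter-positive (x ∷ u) e zero    = e zero
letter-positive (x ∷ u) e (suc i) = letter-positive u (e ∘ suc) i

insertZeros-letter : ∀ {n} (S : Subset n) u → insertZeros (letter u) S ≡ scatter 0 S u
insertZeros-letter []            []      = refl
insertZeros-letter (inside  ∷ S) (x ∷ u) = cong (x ∷_) (insertZeros-letter S u)
insertZeros-letter (outside ∷ S) u       = cong (0 ∷_) (insertZeros-letter S u)

insertZeros-⊤ : ∀ {k} (u : Vec ℕ k) → insertZeros (letter u) (⊤ {k}) ≡ u
insertZeros-⊤ []      = refl
insertZeros-⊤ (x ∷ u) = cong (x ∷_) (insertZeros-⊤ u)

maj-spread : ∀ {n} (S : Subset n) π →
  maj (spread S π) ≡ majFrom 1 (insertZeros (letter (Vec.map toℕ π)) S)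
maj-spread S π = begin
  maj (spread S π)                                         ≡⟨ maj≡majFrom (spread S π) ⟩
  majFrom 1 (Vec.map toℕ (Vec.map (relabel S) raw))        ≡⟨ cong (majFrom 1) (Vecₚ.map-∘ toℕ (relabel S) raw) ⟨
  majFrom 1 (Vec.map (toℕ ∘ relabel S) raw)                ≡⟨ majFrom-map-cong (relabel-<ᵇ S) 1 raw ⟩
  majFrom 1 (Vec.map toℕ raw)                              ≡⟨ cong (majFrom 1) (map-scatter toℕ zero S π) ⟩
  majFrom 1 (scatter 0 S (Vec.map toℕ π))                  ≡⟨ cong (majFrom 1) (insertZeros-letter S (Vec.map toℕ π)) ⟨
  majFrom 1 (insertZeros (letter (Vec.map toℕ π)) S)       ∎
  where
  open ≡-Reasoning
  raw = scatter zero S π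

-- Fractions that are Laurent polynomials

-- Unlike _≃_, this relation to a Laurent polynomial is compatible with ⊕ and ⊗
-- without cancelling denominators.
infix 4 _≃ι_
record _≃ι_ (x : Fraction) (p : Laurent) : Set where
  constructor mk≃ι
  field num-≋ : num x ≋ p * den x
open _≃ι_

ι-≃ι : ∀ p → ι p ≃ι p
ι-≃ι p = mk≃ι (≋-sym (*-identityʳ p))

⊕-≃ι : ∀ x y {p r} → x ≃ι p → y ≃ι r → x ⊕ y ≃ι p + r
⊕-≃ι x y {p} {r} (mk≃ι e) (mk≃ι f) = mk≃ι (≋-trans
  (+-cong (*-congʳ {den y} e) (*-congʳ {den x} f))
  (solve 4 (λ p r a b → p :* a :* b :+ r :* b :* a := (p :+ r) :* (a :* b)) ≋-refl p r (den x) (den y)))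

⊗-≃ι : ∀ x y {p r} → x ≃ι p → y ≃ι r → x ⊗ y ≃ι p * r
⊗-≃ι x y {p} {r} (mk≃ι e) (mk≃ι f) = mk≃ι (≋-trans (*-cong e f)
  (solve 4 (λ p r a b → p :* a :* (r :* b) := (p :* r) :* (a :* b)) ≋-refl p r (den x) (den y)))

∑ᶠ-≃ι : ∀ (xs : List X) f {g} → (∀ {x} → x ∈ˡ xs → f x ≃ι g x) → ∑ᶠ xs f ≃ι ∑ xs g
∑ᶠ-≃ι []       f e = ι-≃ι 0#
∑ᶠ-≃ι (x ∷ xs) f e = ⊕-≃ι (f x) (∑ᶠ xs f) (e (here refl)) (∑ᶠ-≃ι xs f (e ∘ there))

-- Weights and their sums over a fixed support

weight : ∀ {n} → Word n → Laurent
weight σ = q^ (majᵈ σ -ℤ excᵈ σ) * t^ (excᵈ σ +ℤ 1ℤ)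

-- The part of the weight governed by `exc`, common to `π` and all its spreads.
excWeight : ∀ {k} → Word k → Laurent
excWeight π = q^ (ℤ.- (+ exc π)) * t^ (+ exc π)

letters : ∀ {k} → Word k → ℕ → ℕ
letters π = letter (Vec.map toℕ π)

-- With both statistics equal to -1, the exponents of q and t are `-1 - -1` and `-1 + 1`.
weight-θ : ∀ n → weight (θ {n}) ≋ 1#
weight-θ n rewrite dec-true (Vecₚ.≡-dec _≟ᶠ_ (θ {n}) θ) refl = ≋-refl

weight-≢θ : ∀ {n} (σ : Word n) → σ ≢ θ → weight σ ≋ t^ 1ℤ * (excWeight σ * q↑ maj σ)
weight-≢θ σ σ≢θ rewrite dec-false (Vecₚ.≡-dec _≟ᶠ_ σ θ) σ≢θ =
  solve 4 (λ a b c d → a :* b :* (c :* d) := d :* (b :* c :* a)) ≋-refl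
    (q↑ maj σ) (q^ (ℤ.- (+ exc σ))) (t^ (+ exc σ)) (t^ 1ℤ)

-- `S` has an element, and the letter there is nonzero because all letters of `π` are.
spread-≢θ : ∀ {n k} (S : Subset n) {π} → ∣ S ∣ ≡ suc k → IsPermutationOf ⊤ π → spread S π ≢ θ
spread-≢θ S {π} e (_ , closed , _) eθ with j ← subst Fin (sym e) zero with v , _ , e′ ← closed j ∈⊤ =
  0≢1+n (sym (trans (sym (cong (relabel S) e′)) (trans (sym (lookup-spread-embed S π j))
    (trans (cong (λ σ → lookup σ (embed S j)) eθ) (Vecₚ.lookup-replicate (embed S j) zero)))))

spread-∅ : ∀ {n} (S : Subset n) π → ∣ S ∣ ≡ 0 → spread S π ≡ θ
spread-∅ S π e = lookup-ext λ i → trans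
  (lookup-spread-∉ S π {i} λ i∈S → ¬Fin0 (subst Fin e (proj₁ (∈⇒embed i∈S))))
  (sym (Vecₚ.lookup-replicate i zero))

-- `k` is separate from the size of `S`, so that the range of `π` is independent of `S` and the two
-- sums can be exchanged.
permutationSum : ∀ {n} → ℕ → Subset n → Laurent
permutationSum k S = ∑ (permutations k) λ π → excWeight π * q↑ majFrom 1 (insertZeros (letters π) S)

decoratedSum : ∀ {n} → Subset n → Laurent
decoratedSum S = ∑ (permutationsOf S) weight

decoratedSum-spread : ∀ {n} (S : Subset n) → decoratedSum S ≋ ∑ (permutations ∣ S ∣) (weight ∘ spread S)
decoratedSum-spread S = ≋-trans (∑-↭ weight (permutationsOf-↭ S)) (≡⇒≋ (∑-map (spread S) (permutations ∣ S ∣) weight))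

decoratedSum-∅ : ∀ {n} (S : Subset n) → ∣ S ∣ ≡ 0 → decoratedSum S ≋ 1#
decoratedSum-∅ {n} S e = begin
  decoratedSum S                                     ≈⟨ decoratedSum-spread S ⟩
  ∑ (permutations ∣ S ∣) (weight ∘ spread S)         ≈⟨ ∑-cong (permutations ∣ S ∣) (λ {π} _ →
                                                          ≋-trans (≡⇒≋ (cong weight (spread-∅ S π e))) (weight-θ n)) ⟩
  -- `permutations 0` computes to the list of the empty word alone, so the sum becomes `1#`.
  ∑ (permutations ∣ S ∣) (λ _ → 1#)                  ≡⟨ cong (λ k → ∑ (permutations k) (λ _ → 1#)) e ⟩
  1#                                                 ∎
  where open ≋-Reasoning

decoratedSum-suc : ∀ {n} (S : Subset n) {k} → ∣ S ∣ ≡ suc k → decoratedSum S ≋ t^ 1ℤ * permutationSum (suc k) S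
decoratedSum-suc S {k} e = begin
  decoratedSum S
    ≈⟨ decoratedSum-spread S ⟩
  ∑ (permutations ∣ S ∣) (weight ∘ spread S)
    ≈⟨ ∑-cong (permutations ∣ S ∣) (λ {π} π∈ → ≋-trans
         (weight-≢θ (spread S π) (spread-≢θ S {π} e (∈-permutationsOf⁻ ⊤ {π} π∈)))
         (≡⇒≋ (cong₂ (λ x m → t^ 1ℤ * (q^ (ℤ.- (+ x)) * t^ (+ x) * q↑ m)) (exc-spread S π) (maj-spread S π)))) ⟩
  ∑ (permutations ∣ S ∣) (λ π → t^ 1ℤ * (excWeight π * q↑ majFrom 1 (insertZeros (letters π) S)))
    ≈⟨ ∑-*ˡ (permutations ∣ S ∣) (t^ 1ℤ) _ ⟩
  t^ 1ℤ * permutationSum ∣ S ∣ S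
    ≡⟨ cong (λ k → t^ 1ℤ * permutationSum k S) e ⟩
  t^ 1ℤ * permutationSum (suc k) S ∎
  where open ≋-Reasoning

-- Sums over all supports of a given size

sizeSum : ℕ → ℕ → Laurent
sizeSum n k = ∑ₛ n k (permutationSum k)

letters-positive : ∀ {k} {π : Word k} → IsPermutationOf ⊤ π → ∀ i → (0 <ᵇ letters π i) ≡ true
letters-positive {π = π} (_ , closed , _) = letter-positive (Vec.map toℕ π) λ j →
  let _ , _ , e = closed j ∈⊤ in cong (0 <ᵇ_) (trans (Vecₚ.lookup-map j toℕ π) (cong toℕ e))

zeroInsertion-[]q! : ∀ k m (π : Word (suc k)) → IsPermutationOf ⊤ π →
  (∑ₛ (suc k ℕ.+ m) (suc k) λ S → q↑ majFrom 1 (insertZeros (letters π) S)) * ([ suc k ]q! * [ m ]q!) ≋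
  q↑ maj π * [ suc k ℕ.+ m ]q!
zeroInsertion-[]q! k m π p = ≋-trans
  (ZeroInsertion.total-[]q! (letters π) (letters-positive {π = π} p) k m)
  (≡⇒≋ (cong (λ j → q↑ j * [ suc k ℕ.+ m ]q!)
    (trans (cong (majFrom 1) (insertZeros-⊤ (Vec.map toℕ π))) (sym (maj≡majFrom π)))))

∑ₛ-∑ : ∀ n k (xs : List X) (f : X → Subset n → Laurent) →
  ∑ₛ n k (λ S → ∑ xs λ x → f x S) ≋ ∑ xs λ x → ∑ₛ n k (f x)
∑ₛ-∑ n k xs f = ≋-trans
  (∑-cong (allSubsets n) λ {S} _ → ≋-sym (∑-*ˡ xs (δ ∣ S ∣ k) (λ x → f x S)))
  (∑-swap (allSubsets n) xs (λ S x → δ ∣ S ∣ k * f x S))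

-- Once the sums over `S` and `π` are exchanged, zero insertion applies to each `π` separately;
-- `excWeight π` times `q↑ maj π` is the summand of `A`.
sizeSum-[]q! : ∀ k m →
  sizeSum (suc k ℕ.+ m) (suc k) * ([ suc k ]q! * [ m ]q!) ≋ [ suc k ℕ.+ m ]q! * A (suc k)
sizeSum-[]q! k m = begin
  sizeSum n (suc k) * d
    ≈⟨ *-comm (sizeSum n (suc k)) d ⟩
  d * sizeSum n (suc k)
    ≈⟨ *-congˡ d (≋-trans (∑ₛ-∑ n (suc k) perms _) (∑-cong perms λ {π} _ → ∑ₛ-*ˡ n (suc k) (excWeight π) _)) ⟩
  d * ∑ perms (λ π → excWeight π * total π)
    ≈⟨ ∑-*ˡ perms d _ ⟨
  ∑ perms (λ π → d * (excWeight π * total π))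
    ≈⟨ ∑-cong perms (λ {π} π∈ → perPermutation π (∈-permutationsOf⁻ ⊤ {π} π∈)) ⟩
  ∑ perms (λ π → [ n ]q! * (q^ (+ maj π -ℤ + exc π) * t^ (+ exc π)))
    ≈⟨ ∑-*ˡ perms [ n ]q! _ ⟩
  [ n ]q! * A (suc k) ∎
  where
  open ≋-Reasoning
  n = suc k ℕ.+ m
  d = [ suc k ]q! * [ m ]q!
  perms = permutations (suc k)
  total : Word (suc k) → Laurent
  total π = ∑ₛ n (suc k) λ S → q↑ majFrom 1 (insertZeros (letters π) S)
  perPermutation : ∀ π → IsPermutationOf ⊤ π →
    d * (excWeight π * total π) ≋ [ n ]q! * (q^ (+ maj π -ℤ + exc π) * t^ (+ exc π))
  perPermutation π p = begin
    d * (excWeight π * total π)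
      ≈⟨ solve 3 (λ d c x → d :* (c :* x) := c :* (x :* d)) ≋-refl d (excWeight π) (total π) ⟩
    excWeight π * (total π * d)
      ≈⟨ *-congˡ (excWeight π) (zeroInsertion-[]q! k m π p) ⟩
    excWeight π * (q↑ maj π * [ n ]q!)
      ≈⟨ solve 4 (λ a b c h → a :* b :* (c :* h) := h :* (c :* a :* b)) ≋-refl
           (q^ (ℤ.- (+ exc π))) (t^ (+ exc π)) (q↑ maj π) [ n ]q! ⟩
    [ n ]q! * (q^ (+ maj π -ℤ + exc π) * t^ (+ exc π)) ∎

-- This is `sizeSum-[]q!` at `m = n ∸ suc k`, read as an identity of fractions.
qBinomial-⊗-A : ∀ {n k} → k < n → qBinomial n (suc k) ⊗ ι (A (suc k)) ≃ι sizeSum n (suc k)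
qBinomial-⊗-A {n} {k} k<n = mk≃ι (≋-trans
  (≋-sym (subst (λ N → sizeSum N (suc k) * d ≋ [ N ]q! * A (suc k))
    (ℕₚ.m+[n∸m]≡n k<n) (sizeSum-[]q! k (n ∸ suc k))))
  (*-congˡ (sizeSum n (suc k)) (≋-sym (*-identityʳ d))))
  where d = [ suc k ]q! * [ n ∸ suc k ]q!

-- Summation over all sizes

∑ₛ-0-1# : ∀ n → ∑ₛ n 0 (λ _ → 1#) ≋ 1#
∑ₛ-0-1# zero    = ≋-refl
∑ₛ-0-1# (suc n) = ≋-trans (∑ₛ-∷ʳ-zero n _) (∑ₛ-0-1# n)

-- Since `∣ S ∣` is at most `n`, the indicators `δ ∣ S ∣ k` for `k` from 0 to `n` add up to 1;
-- insert this sum and exchange.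
∑-bySize : ∀ n f → ∑ (allSubsets n) f ≋ ∑ (upTo (suc n)) λ k → ∑ₛ n k f
∑-bySize n f = begin
  ∑ (allSubsets n) f
    ≈⟨ ∑-cong (allSubsets n) (λ {S} _ → ≋-trans (≋-sym (*-identityʳ (f S)))
         (*-congˡ (f S) (≋-sym (∑δ (s≤s (∣p∣≤n S)))))) ⟩
  ∑ (allSubsets n) (λ S → f S * ∑ (upTo (suc n)) (δ ∣ S ∣))
    ≈⟨ ∑-cong (allSubsets n) (λ {S} _ → ≋-trans (≋-sym (∑-*ˡ (upTo (suc n)) (f S) (δ ∣ S ∣)))
         (∑-cong (upTo (suc n)) λ {k} _ → *-comm (f S) (δ ∣ S ∣ k))) ⟩
  ∑ (allSubsets n) (λ S → ∑ (upTo (suc n)) λ k → δ ∣ S ∣ k * f S)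
    ≈⟨ ∑-swap (allSubsets n) (upTo (suc n)) (λ S k → δ ∣ S ∣ k * f S) ⟩
  ∑ (upTo (suc n)) (λ k → ∑ₛ n k f) ∎
  where open ≋-Reasoning

-- Size 0 contributes only `θ`, which gives the summand 1; every larger size has the factor `t^ 1ℤ`.
∑-decoratedPermutations : ∀ n →
  ∑ (decoratedPermutations n) weight ≋ 1# + t^ 1ℤ * ∑ (map suc (upTo n)) (sizeSum n)
∑-decoratedPermutations n = begin
  ∑ (decoratedPermutations n) weight
    ≈⟨ ∑-concatMap permutationsOf (allSubsets n) weight ⟩
  ∑ (allSubsets n) decoratedSum
    ≈⟨ ∑-bySize n decoratedSum ⟩
  ∑ (upTo (suc n)) (λ k → ∑ₛ n k decoratedSum)
    ≡⟨ ∑-upTo-suc n _ ⟩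
  ∑ₛ n 0 decoratedSum + ∑ (upTo n) (λ k → ∑ₛ n (suc k) decoratedSum)
    ≈⟨ +-cong (≋-trans (∑ₛ-cong n 0 decoratedSum-∅) (∑ₛ-0-1# n))
         (∑-cong (upTo n) λ {k} _ → ≋-trans
           (∑ₛ-cong n (suc k) λ S → decoratedSum-suc S)
           (∑ₛ-*ˡ n (suc k) (t^ 1ℤ) (permutationSum (suc k)))) ⟩
  1# + ∑ (upTo n) (λ k → t^ 1ℤ * sizeSum n (suc k))
    ≈⟨ +-congˡ {1#} (∑-*ˡ (upTo n) (t^ 1ℤ) _) ⟩
  1# + t^ 1ℤ * ∑ (upTo n) (λ k → sizeSum n (suc k))
    ≡⟨ cong (λ s → 1# + t^ 1ℤ * s) (∑-map suc (upTo n) (sizeSum n)) ⟨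
  1# + t^ 1ℤ * ∑ (map suc (upTo n)) (sizeSum n) ∎
  where open ≋-Reasoning

Ã-≃ι : ∀ n → Ã n ≃ι 1# + t^ 1ℤ * ∑ (map suc (upTo n)) (sizeSum n)
Ã-≃ι n = ⊕-≃ι (ι 1#) (ι (t^ 1ℤ) ⊗ ∑ᶠ ks f) (ι-≃ι 1#)
  (⊗-≃ι (ι (t^ 1ℤ)) (∑ᶠ ks f) (ι-≃ι (t^ 1ℤ)) (∑ᶠ-≃ι ks f summand))
  where
  ks = map suc (upTo n)
  f : ℕ → Fraction
  f k = qBinomial n k ⊗ ι (A k)
  summand : ∀ {k} → k ∈ˡ ks → f k ≃ι sizeSum n k
  summand k∈ with _ , j∈ , refl ← ∈-map⁻ suc k∈ = qBinomial-⊗-A (∈-upTo⁻ j∈)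

theorem6p18 : ∀ (n : ℕ) →
    Ã n ≃ ι (∑ (decoratedPermutations n) (λ σ → q^ (majᵈ σ -ℤ excᵈ σ) * t^ (excᵈ σ +ℤ 1ℤ)))
-- The denominator of `ι` is `1#`, so cross-multiplication is `_≃ι_` up to the factor `1#` on the
-- left.
theorem6p18 n = coeff-≡ (≋-trans (*-identityʳ (num (Ã n)))
  (≋-trans (num-≋ (Ã-≃ι n)) (*-congʳ {den (Ã n)} (≋-sym (∑-decoratedPermutations n)))))
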